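{- Let $n \geq 2$ be an integer and let $f(x) \in \mathbb{C}[x]$ be monic and separable of degree $n$. Then \[\operatorname{sep}(f) \leq \min\left\{2,\frac{34}{\sqrt{n}}\right\}M(f)^{1/(n-1)}.\] If, in addition, $f(x) \in \mathbb{R}[x]$ and at least one of the complex roots of $f(x)$ of minimum absolute value (among all roots of $f$) is not real (for example, if $f(x) \in \mathbb{R}[x]$ has no real roots), then \[\operatorname{sep}(f) \leq \min\left\{2,\frac{34}{\sqrt{n}}\right\} M(f)^{1/n}.\]
   Context: For a polynomial $f(x)\in\mathbb{C}[x]$ with roots $\alpha_1,\dots,\alpha_n\in\mathbb{C}$, the separation of $f$ is $\operatorname{sep}(f) := \min_{\alpha_i\neq\alpha_j}|\alpha_i-\alpha_j|$. For a monic polynomial $f(x)\in\mathbb{C}[x]$ with roots $\alpha_1,\dots,\alpha_n$ (with multiplicity), the Mahler measure of $f$ is $M(f) := \prod_{i=1}^n\max\{1,|\alpha_i|\}$. Separable means that $f$ has $n=\deg f$ distinct complex roots. -}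

module Defs where

open import Data.Bool.Base using (if_then_else_)
open import Data.Fin.Base using (Fin)
import Data.Fin.Properties as Fin
open import Data.Integer.Base as ℤ using (+_)
import Data.Integer.Properties as ℤ
open import Data.List.Base
  using (List; []; _∷_; map; filter; allFin; cartesianProduct)
open import Data.List.Relation.Unary.All using (All)
open import Data.Nat.Base as ℕ using (ℕ; zero; suc)
import Data.Nat.Properties as ℕ
open import Data.Product.Base using (_×_; _,_; ∃; ∃-syntax; proj₁; proj₂)
open import Data.Rational.Base as ℚ using (ℚ; 0ℚ; 1ℚ; ½)
import Data.Rational.Properties as ℚ
import Data.Rational.Unnormalised.Base as ℚᵘ
import Data.Rational.Unnormalised.Properties as ℚᵘ
open import Data.Rational.Solver using (module +-*-Solver)
open import Algebra.Definitions.RawSemiring ℚ.+-*-rawSemiring using (_^_)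
open import Data.Sum.Base using (inj₁; inj₂)
open import Data.Vec.Functional using (Vector; foldr)
open import Function.Base using (_∘_)
open import Relation.Binary.PropositionalEquality
  using (_≡_; _≢_; refl; sym; trans; cong; cong₂; subst)
open import Relation.Nullary
  using (¬_; Dec; does; yes; no; ¬?; contradiction)

------------------------------------------------------------------------
-- Real numbers: Cauchy sequences of rationals, up to _≃_

IsCauchy : (ℕ → ℚ) → Set
IsCauchy x = ∀ ε → 0ℚ ℚ.< ε →
  ∃[ N ] (∀ m n → N ℕ.≤ m → N ℕ.≤ n → ℚ.∣ x m ℚ.- x n ∣ ℚ.< ε)

record ℝ : Set where
  constructor mkℝ
  field
    seq    : ℕ → ℚ
    cauchy : IsCauchy seq

open ℝ public

infix 4 _≃_ _≤ᴿ_ _<ᴿ_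

_≃_ : ℝ → ℝ → Set
x ≃ y = ∀ ε → 0ℚ ℚ.< ε →
  ∃[ N ] (∀ n → N ℕ.≤ n → ℚ.∣ seq x n ℚ.- seq y n ∣ ℚ.< ε)

_≤ᴿ_ : ℝ → ℝ → Set
x ≤ᴿ y = ∀ ε → 0ℚ ℚ.< ε →
  ∃[ N ] (∀ n → N ℕ.≤ n → seq x n ℚ.≤ seq y n ℚ.+ ε)

_<ᴿ_ : ℝ → ℝ → Set
x <ᴿ y = ∃[ δ ] (0ℚ ℚ.< δ ×
  ∃[ N ] (∀ n → N ℕ.≤ n → seq x n ℚ.+ δ ℚ.≤ seq y n))

------------------------------------------------------------------------
-- Auxiliary facts about rationals

abstract

  half+half : ∀ ε → ½ ℚ.* ε ℚ.+ ½ ℚ.* ε ≡ ε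
  half+half ε = trans (sym (ℚ.*-distribʳ-+ ε ½ ½)) (ℚ.*-identityˡ ε)

  *-pos : ∀ {p q} → 0ℚ ℚ.< p → 0ℚ ℚ.< q → 0ℚ ℚ.< p ℚ.* q
  *-pos {p} {q} 0<p 0<q = ℚ.positive⁻¹ (p ℚ.* q)
    {{ℚ.pos*pos⇒pos p {{ℚ.positive 0<p}} q {{ℚ.positive 0<q}}}}

  *-nonNeg : ∀ {p q} → 0ℚ ℚ.≤ p → 0ℚ ℚ.≤ q → 0ℚ ℚ.≤ p ℚ.* q
  *-nonNeg {p} {q} 0≤p 0≤q = ℚ.nonNegative⁻¹ (p ℚ.* q)
    {{ℚ.nonNeg*nonNeg⇒nonNeg p {{ℚ.nonNegative 0≤p}} q {{ℚ.nonNegative 0≤q}}}}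

  half-pos : ∀ {ε} → 0ℚ ℚ.< ε → 0ℚ ℚ.< ½ ℚ.* ε
  half-pos = *-pos (ℚ.positive⁻¹ ½)

  *-mono-≤ : ∀ {a b c d} → 0ℚ ℚ.≤ a → 0ℚ ℚ.≤ d →
             a ℚ.≤ b → c ℚ.≤ d → a ℚ.* c ℚ.≤ b ℚ.* d
  *-mono-≤ {a} {b} {c} {d} 0≤a 0≤d a≤b c≤d = ℚ.≤-trans
    (ℚ.*-monoˡ-≤-nonNeg a {{ℚ.nonNegative 0≤a}} c≤d)
    (ℚ.*-monoʳ-≤-nonNeg d {{ℚ.nonNegative 0≤d}} a≤b)

  a-b+b : ∀ a b → (a ℚ.- b) ℚ.+ b ≡ a
  a-b+b = solve 2 (λ a b → (a :- b) :+ b := a) refl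
    where open +-*-Solver

  -[a-b]+a : ∀ a b → ℚ.- (a ℚ.- b) ℚ.+ a ≡ b
  -[a-b]+a = solve 2 (λ a b → :- (a :- b) :+ a := b) refl
    where open +-*-Solver

  p≤∣p∣ : ∀ p → p ℚ.≤ ℚ.∣ p ∣
  p≤∣p∣ p with ℚ.≤-total 0ℚ p
  ... | inj₁ 0≤p = ℚ.≤-reflexive (sym (ℚ.0≤p⇒∣p∣≡p 0≤p))
  ... | inj₂ p≤0 = ℚ.≤-trans p≤0 (ℚ.0≤∣p∣ p)

  close⇒< : ∀ {a b ε} → ℚ.∣ a ℚ.- b ∣ ℚ.< ε → a ℚ.< b ℚ.+ ε
  close⇒< {a} {b} {ε} h =
    subst (ℚ._< b ℚ.+ ε) (trans (ℚ.+-comm b (a ℚ.- b)) (a-b+b a b))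
      (ℚ.+-monoʳ-< b (ℚ.≤-<-trans (p≤∣p∣ (a ℚ.- b)) h))

  a+b-a : ∀ a b → (a ℚ.+ b) ℚ.- a ≡ b
  a+b-a = solve 2 (λ a b → (a :+ b) :- a := b) refl
    where open +-*-Solver

  -[a-b] : ∀ a b → b ℚ.- a ≡ ℚ.- (a ℚ.- b)
  -[a-b] = solve 2 (λ a b → b :- a := :- (a :- b)) refl
    where open +-*-Solver

  <⇒close : ∀ {a b ε} → a ℚ.< b ℚ.+ ε → b ℚ.< a ℚ.+ ε → ℚ.∣ a ℚ.- b ∣ ℚ.< ε
  <⇒close {a} {b} {ε} a< b< with ℚ.∣p∣≡p∨∣p∣≡-p (a ℚ.- b)
  ... | inj₁ e = subst (ℚ._< ε) (sym e)
    (subst ((a ℚ.- b) ℚ.<_) (a+b-a b ε) (ℚ.+-monoˡ-< (ℚ.- b) a<))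
  ... | inj₂ e = subst (ℚ._< ε) (sym (trans e (sym (-[a-b] a b))))
    (subst ((b ℚ.- a) ℚ.<_) (a+b-a a ε) (ℚ.+-monoˡ-< (ℚ.- a) b<))

OneSidedCauchy : (ℕ → ℚ) → Set
OneSidedCauchy x = ∀ ε → 0ℚ ℚ.< ε →
  ∃[ N ] (∀ m n → N ℕ.≤ m → N ℕ.≤ n → x m ℚ.< x n ℚ.+ ε)

abstract

  fromOneSided : ∀ {x} → OneSidedCauchy x → IsCauchy x
  fromOneSided h ε 0<ε with h ε 0<ε
  ... | N , p = N , λ m n N≤m N≤n → <⇒close (p m n N≤m N≤n) (p n m N≤n N≤m)

  toOneSided : ∀ {x} → IsCauchy x → OneSidedCauchy x
  toOneSided h ε 0<ε with h ε 0<ε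
  ... | N , p = N , λ m n N≤m N≤n → close⇒< (p m n N≤m N≤n)

  cauchy₂ : ∀ (f : ℚ → ℚ → ℚ) →
    (∀ {ε a b c d} → a ℚ.< c ℚ.+ ε → b ℚ.< d ℚ.+ ε → 0ℚ ℚ.< ε →
       f a b ℚ.< f c d ℚ.+ (ε ℚ.+ ε)) →
    ∀ {x y} → IsCauchy x → IsCauchy y → IsCauchy (λ n → f (x n) (y n))
  cauchy₂ f fc {x} {y} cx cy = fromOneSided {λ n → f (x n) (y n)} λ ε 0<ε →
    let N₁ , p₁ = toOneSided {x} cx (½ ℚ.* ε) (half-pos 0<ε)
        N₂ , p₂ = toOneSided {y} cy (½ ℚ.* ε) (half-pos 0<ε)
    in N₁ ℕ.⊔ N₂ , λ m n N≤m N≤n →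
      subst (λ e → f (x m) (y m) ℚ.< f (x n) (y n) ℚ.+ e) (half+half ε)
        (fc (p₁ m n (ℕ.m⊔n≤o⇒m≤o N₁ N₂ N≤m) (ℕ.m⊔n≤o⇒m≤o N₁ N₂ N≤n))
            (p₂ m n (ℕ.m⊔n≤o⇒n≤o N₁ N₂ N≤m) (ℕ.m⊔n≤o⇒n≤o N₁ N₂ N≤n))
            (half-pos 0<ε))

------------------------------------------------------------------------
-- Arithmetic and lattice operations

abstract

  const-cauchy : ∀ q → IsCauchy (λ _ → q)
  const-cauchy q ε 0<ε = 0 , λ _ _ _ _ →
    subst (λ e → ℚ.∣ e ∣ ℚ.< ε) (sym (ℚ.+-inverseʳ q)) 0<ε

  interchange : ∀ a b c d → (a ℚ.+ b) ℚ.+ (c ℚ.+ d) ≡ (a ℚ.+ c) ℚ.+ (b ℚ.+ d)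
  interchange = solve 4 (λ a b c d → (a :+ b) :+ (c :+ d) := (a :+ c) :+ (b :+ d)) refl
    where open +-*-Solver

  +-cauchy : ∀ {x y} → IsCauchy x → IsCauchy y → IsCauchy (λ n → x n ℚ.+ y n)
  +-cauchy {x} {y} = cauchy₂ ℚ._+_ (λ {ε} {a} {b} {c} {d} p q _ →
    subst (a ℚ.+ b ℚ.<_) (interchange c ε d ε) (ℚ.+-mono-< p q)) {x} {y}

  weaken : ∀ {a c ε} → a ℚ.< c ℚ.+ ε → 0ℚ ℚ.< ε → a ℚ.< c ℚ.+ (ε ℚ.+ ε)
  weaken {a} {c} {ε} p 0<ε = ℚ.<-≤-trans p (ℚ.+-monoʳ-≤ c
    (subst (ℚ._≤ ε ℚ.+ ε) (ℚ.+-identityʳ ε) (ℚ.+-monoʳ-≤ ε (ℚ.<⇒≤ 0<ε))))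

  ⊔-cauchy : ∀ {x y} → IsCauchy x → IsCauchy y → IsCauchy (λ n → x n ℚ.⊔ y n)
  ⊔-cauchy {x} {y} = cauchy₂ ℚ._⊔_
    (λ {ε} {a} {b} {c} {d} p q 0<ε → case ε a b c d p q 0<ε) {x} {y}
    where
    case : ∀ ε a b c d → a ℚ.< c ℚ.+ ε → b ℚ.< d ℚ.+ ε → 0ℚ ℚ.< ε →
           a ℚ.⊔ b ℚ.< c ℚ.⊔ d ℚ.+ (ε ℚ.+ ε)
    case ε a b c d p q 0<ε with ℚ.≤-total a b
    ... | inj₁ a≤b = subst (ℚ._< c ℚ.⊔ d ℚ.+ (ε ℚ.+ ε)) (sym (ℚ.p≤q⇒p⊔q≡q a≤b))
      (ℚ.<-≤-trans (weaken {b} {d} q 0<ε) (ℚ.+-monoˡ-≤ (ε ℚ.+ ε) (ℚ.p≤q⊔p c d)))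
    ... | inj₂ b≤a = subst (ℚ._< c ℚ.⊔ d ℚ.+ (ε ℚ.+ ε)) (sym (ℚ.p≥q⇒p⊔q≡p b≤a))
      (ℚ.<-≤-trans (weaken {a} {c} p 0<ε) (ℚ.+-monoˡ-≤ (ε ℚ.+ ε) (ℚ.p≤p⊔q c d)))

  ⊓-cauchy : ∀ {x y} → IsCauchy x → IsCauchy y → IsCauchy (λ n → x n ℚ.⊓ y n)
  ⊓-cauchy {x} {y} = cauchy₂ ℚ._⊓_
    (λ {ε} {a} {b} {c} {d} p q 0<ε → case ε a b c d p q 0<ε) {x} {y}
    where
    case : ∀ ε a b c d → a ℚ.< c ℚ.+ ε → b ℚ.< d ℚ.+ ε → 0ℚ ℚ.< ε →
           a ℚ.⊓ b ℚ.< c ℚ.⊓ d ℚ.+ (ε ℚ.+ ε)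
    case ε a b c d p q 0<ε with ℚ.≤-total c d
    ... | inj₁ c≤d = subst (λ e → a ℚ.⊓ b ℚ.< e ℚ.+ (ε ℚ.+ ε)) (sym (ℚ.p≤q⇒p⊓q≡p c≤d))
      (ℚ.≤-<-trans (ℚ.p⊓q≤p a b) (weaken {a} {c} p 0<ε))
    ... | inj₂ d≤c = subst (λ e → a ℚ.⊓ b ℚ.< e ℚ.+ (ε ℚ.+ ε)) (sym (ℚ.p≥q⇒p⊓q≡q d≤c))
      (ℚ.≤-<-trans (ℚ.p⊓q≤q a b) (weaken {b} {d} q 0<ε))

  neg-cauchy : ∀ {x} → IsCauchy x → IsCauchy (λ n → ℚ.- x n)
  neg-cauchy {x} cx ε 0<ε with cx ε 0<ε
  ... | N , p = N , λ m n N≤m N≤n → subst (ℚ._< ε)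
    (trans (sym (ℚ.∣-p∣≡∣p∣ (x m ℚ.- x n)))
           (cong ℚ.∣_∣ (ℚ.neg-distrib-+ (x m) (ℚ.- x n))))
    (p m n N≤m N≤n)

  eventuallyBounded : ∀ {x} → IsCauchy x →
    ∃[ B ] (0ℚ ℚ.< B × ∃[ N ] (∀ n → N ℕ.≤ n → ℚ.∣ x n ∣ ℚ.≤ B))
  eventuallyBounded {x} cx with cx 1ℚ (ℚ.positive⁻¹ 1ℚ)
  ... | N , p = 1ℚ ℚ.+ ℚ.∣ x N ∣
    , subst (ℚ._< 1ℚ ℚ.+ ℚ.∣ x N ∣) (ℚ.+-identityʳ 0ℚ)
        (ℚ.+-mono-<-≤ (ℚ.positive⁻¹ 1ℚ) (ℚ.0≤∣p∣ (x N)))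
    , N , λ n N≤n → subst (λ e → ℚ.∣ e ∣ ℚ.≤ 1ℚ ℚ.+ ℚ.∣ x N ∣) (a-b+b (x n) (x N))
        (ℚ.≤-trans (ℚ.∣p+q∣≤∣p∣+∣q∣ (x n ℚ.- x N) (x N))
          (ℚ.+-monoˡ-≤ ℚ.∣ x N ∣ (ℚ.<⇒≤ (p n N N≤n ℕ.≤-refl))))

  *-difference : ∀ a b c d →
    a ℚ.* (b ℚ.- d) ℚ.+ d ℚ.* (a ℚ.- c) ≡ a ℚ.* b ℚ.- c ℚ.* d
  *-difference = solve 4 (λ a b c d →
    a :* (b :- d) :+ d :* (a :- c) := a :* b :- c :* d) refl
    where open +-*-Solver

  -- For B > 0, a tolerance η > 0 with B η = ε.
  divide-tolerance : ∀ B ε → 0ℚ ℚ.< B → 0ℚ ℚ.< ε → ∃[ η ] (0ℚ ℚ.< η × B ℚ.* η ≡ ε)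
  divide-tolerance B ε 0<B 0<ε = 1/B ℚ.* ε
    , *-pos (ℚ.positive⁻¹ 1/B {{ℚ.1/pos⇒pos B {{ℚ.positive 0<B}}}}) 0<ε
    , trans (sym (ℚ.*-assoc B 1/B ε))
        (trans (cong (ℚ._* ε) (ℚ.*-inverseʳ B {{ℚ.>-nonZero 0<B}})) (ℚ.*-identityˡ ε))
    where
    1/B : ℚ
    1/B = ℚ.1/_ B {{ℚ.>-nonZero 0<B}}

  *-cauchy : ∀ {x y} → IsCauchy x → IsCauchy y → IsCauchy (λ n → x n ℚ.* y n)
  *-cauchy {x} {y} cx cy ε 0<ε =
    let B , 0<B , N₁ , bx = eventuallyBounded {x} cx
        C , 0<C , N₂ , by = eventuallyBounded {y} cy
        η , 0<η , Bη = divide-tolerance B (½ ℚ.* ε) 0<B (half-pos 0<ε)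
        θ , 0<θ , Cθ = divide-tolerance C (½ ℚ.* ε) 0<C (half-pos 0<ε)
        N₃ , px = cx θ 0<θ
        N₄ , py = cy η 0<η
        L = N₁ ℕ.⊔ N₂
        R = N₃ ℕ.⊔ N₄
    in L ℕ.⊔ R , λ m n N≤m N≤n →
      let N₁≤m = ℕ.m⊔n≤o⇒m≤o N₁ N₂ (ℕ.m⊔n≤o⇒m≤o L R N≤m)
          N₂≤n = ℕ.m⊔n≤o⇒n≤o N₁ N₂ (ℕ.m⊔n≤o⇒m≤o L R N≤n)
          N₃≤m = ℕ.m⊔n≤o⇒m≤o N₃ N₄ (ℕ.m⊔n≤o⇒n≤o L R N≤m)
          N₃≤n = ℕ.m⊔n≤o⇒m≤o N₃ N₄ (ℕ.m⊔n≤o⇒n≤o L R N≤n)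
          N₄≤m = ℕ.m⊔n≤o⇒n≤o N₃ N₄ (ℕ.m⊔n≤o⇒n≤o L R N≤m)
          N₄≤n = ℕ.m⊔n≤o⇒n≤o N₃ N₄ (ℕ.m⊔n≤o⇒n≤o L R N≤n)
          u = x m ℚ.* (y m ℚ.- y n)
          v = y n ℚ.* (x m ℚ.- x n)
          u< : ℚ.∣ u ∣ ℚ.< ½ ℚ.* ε
          u< = subst (ℚ.∣ u ∣ ℚ.<_) Bη
                 (term (x m) (y m ℚ.- y n) 0<B (bx m N₁≤m) (py m n N₄≤m N₄≤n))
          v< : ℚ.∣ v ∣ ℚ.< ½ ℚ.* ε
          v< = subst (ℚ.∣ v ∣ ℚ.<_) Cθ
                 (term (y n) (x m ℚ.- x n) 0<C (by n N₂≤n) (px m n N₃≤m N₃≤n))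
      in subst (λ e → ℚ.∣ e ∣ ℚ.< ε) (*-difference (x m) (y m) (x n) (y n))
           (ℚ.≤-<-trans (ℚ.∣p+q∣≤∣p∣+∣q∣ u v)
             (subst (ℚ.∣ u ∣ ℚ.+ ℚ.∣ v ∣ ℚ.<_) (half+half ε) (ℚ.+-mono-< u< v<)))
    where
    term : ∀ {B η} a e → 0ℚ ℚ.< B → ℚ.∣ a ∣ ℚ.≤ B → ℚ.∣ e ∣ ℚ.< η →
           ℚ.∣ a ℚ.* e ∣ ℚ.< B ℚ.* η
    term {B} {η} a e 0<B a≤B e<η = subst (ℚ._< B ℚ.* η) (sym (ℚ.∣p*q∣≡∣p∣*∣q∣ a e))
      (ℚ.≤-<-trans
        (ℚ.*-monoʳ-≤-nonNeg ℚ.∣ e ∣ {{ℚ.nonNegative (ℚ.0≤∣p∣ e)}} a≤B)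
        (ℚ.*-monoʳ-<-pos B {{ℚ.positive 0<B}} e<η))

fromℚ : ℚ → ℝ
fromℚ q = mkℝ (λ _ → q) (const-cauchy q)

fromℕ : ℕ → ℝ
fromℕ n = fromℚ (+ n ℚ./ 1)

0ᴿ 1ᴿ : ℝ
0ᴿ = fromℕ 0
1ᴿ = fromℕ 1

infixl 6 _+ᴿ_ _-ᴿ_ _⊔ᴿ_
infixl 7 _*ᴿ_ _⊓ᴿ_
infix  8 -ᴿ_

-ᴿ_ : ℝ → ℝ
-ᴿ x = mkℝ (λ n → ℚ.- seq x n) (neg-cauchy {seq x} (cauchy x))

_+ᴿ_ _*ᴿ_ _⊔ᴿ_ _⊓ᴿ_ : ℝ → ℝ → ℝ
x +ᴿ y = mkℝ (λ n → seq x n ℚ.+ seq y n) (+-cauchy {seq x} {seq y} (cauchy x) (cauchy y))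
x *ᴿ y = mkℝ (λ n → seq x n ℚ.* seq y n) (*-cauchy {seq x} {seq y} (cauchy x) (cauchy y))
x ⊔ᴿ y = mkℝ (λ n → seq x n ℚ.⊔ seq y n) (⊔-cauchy {seq x} {seq y} (cauchy x) (cauchy y))
x ⊓ᴿ y = mkℝ (λ n → seq x n ℚ.⊓ seq y n) (⊓-cauchy {seq x} {seq y} (cauchy x) (cauchy y))

_-ᴿ_ : ℝ → ℝ → ℝ
x -ᴿ y = x +ᴿ (-ᴿ y)

------------------------------------------------------------------------
-- Division by a positive real

abstract

  0<q⊔δ : ∀ {δ} q → 0ℚ ℚ.< δ → 0ℚ ℚ.< q ℚ.⊔ δ
  0<q⊔δ {δ} q 0<δ = ℚ.<-≤-trans 0<δ (ℚ.p≤q⊔p q δ)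

-- If 0 < δ ≤ xₙ for all large n, then (cutRecip δ _ xₙ) is eventually 1/xₙ.
cutRecip : ∀ δ → 0ℚ ℚ.< δ → ℚ → ℚ
cutRecip δ 0<δ q = ℚ.1/_ (q ℚ.⊔ δ) {{ℚ.>-nonZero (0<q⊔δ q 0<δ)}}

abstract

  recip-< : ∀ {A B A⁻¹ B⁻¹ δ ε} → A ℚ.* A⁻¹ ≡ 1ℚ → B ℚ.* B⁻¹ ≡ 1ℚ →
    0ℚ ℚ.< δ → δ ℚ.≤ A → δ ℚ.≤ B → 0ℚ ℚ.< ε →
    B ℚ.< A ℚ.+ δ ℚ.* δ ℚ.* ε → A⁻¹ ℚ.< B⁻¹ ℚ.+ ε
  recip-< {A} {B} {A⁻¹} {B⁻¹} {δ} {ε} eA eB 0<δ δ≤A δ≤B 0<ε B<A+ =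
    ℚ.*-cancelˡ-<-nonNeg (A ℚ.* B) {{ℚ.nonNegative (ℚ.<⇒≤ (*-pos 0<A 0<B))}}
      (subst₂< lhs rhs
        (ℚ.<-≤-trans B<A+ (ℚ.+-monoʳ-≤ A
          (ℚ.*-monoʳ-≤-nonNeg ε {{ℚ.nonNegative (ℚ.<⇒≤ 0<ε)}}
            (*-mono-≤ (ℚ.<⇒≤ 0<δ) (ℚ.<⇒≤ 0<B) δ≤A δ≤B)))))
    where
    open +-*-Solver
    0<A : 0ℚ ℚ.< A
    0<A = ℚ.<-≤-trans 0<δ δ≤A
    0<B : 0ℚ ℚ.< B
    0<B = ℚ.<-≤-trans 0<δ δ≤B
    subst₂< : ∀ {a b c d} → a ≡ b → c ≡ d → b ℚ.< d → a ℚ.< c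
    subst₂< refl refl h = h
    lhs : A ℚ.* B ℚ.* A⁻¹ ≡ B
    lhs = trans (solve 3 (λ a b c → a :* b :* c := b :* (a :* c)) refl A B A⁻¹)
            (trans (cong (B ℚ.*_) eA) (ℚ.*-identityʳ B))
    rhs : A ℚ.* B ℚ.* (B⁻¹ ℚ.+ ε) ≡ A ℚ.+ A ℚ.* B ℚ.* ε
    rhs = trans (solve 4 (λ a b c e → a :* b :* (c :+ e) := a :* (b :* c) :+ a :* b :* e)
                   refl A B B⁻¹ ε)
            (cong (ℚ._+ A ℚ.* B ℚ.* ε) (trans (cong (A ℚ.*_) eB) (ℚ.*-identityʳ A)))

  recip-cauchy : ∀ {x} δ (0<δ : 0ℚ ℚ.< δ) → IsCauchy x → IsCauchy (λ n → cutRecip δ 0<δ (x n))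
  recip-cauchy {x} δ 0<δ cx = fromOneSided {λ n → cutRecip δ 0<δ (x n)} λ ε 0<ε →
    let N , p = toOneSided {λ n → x n ℚ.⊔ δ} (⊔-cauchy {x} {λ _ → δ} cx (const-cauchy δ))
                  (δ ℚ.* δ ℚ.* ε) (*-pos (*-pos 0<δ 0<δ) 0<ε)
    in N , λ m n N≤m N≤n → recip-< (inv (x m)) (inv (x n)) 0<δ
             (ℚ.p≤q⊔p (x m) δ) (ℚ.p≤q⊔p (x n) δ) 0<ε (p n m N≤n N≤m)
    where
    inv : ∀ q → (q ℚ.⊔ δ) ℚ.* cutRecip δ 0<δ q ≡ 1ℚ
    inv q = ℚ.*-inverseʳ (q ℚ.⊔ δ) {{ℚ.>-nonZero (0<q⊔δ q 0<δ)}}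

recip : ∀ x → 0ᴿ <ᴿ x → ℝ
recip x (δ , 0<δ , _) =
  mkℝ (λ n → cutRecip δ 0<δ (seq x n)) (recip-cauchy {seq x} δ 0<δ (cauchy x))

------------------------------------------------------------------------
-- k-th roots of nonnegative reals

-- The largest j ≤ b with (j / (m + 1)) ^ k ≤ q, and 0 if there is none.
searchRoot : (k : ℕ) → ℚ → ℕ → ℕ → ℕ
searchRoot k q m zero    = zero
searchRoot k q m (suc b) =
  if does ((+ suc b ℚ./ suc m) ^ k ℚ.≤? q) then suc b else searchRoot k q m b

-- For k ≥ 1 and q ≥ 0, the approximation from below to q ^ (1/k) by a
-- multiple of 1 / (m + 1), with error less than 1 / (m + 1).
opaque

  rootApprox : (k : ℕ) → ℚ → ℕ → ℚ
  rootApprox k q m = + searchRoot k q m (suc m ℕ.* suc ℤ.∣ ℚ.↥ q ∣) ℚ./ suc m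

unit : ℕ → ℚ
unit m = + 1 ℚ./ suc m

abstract

  /-nonNeg : ∀ j m → 0ℚ ℚ.≤ + j ℚ./ suc m
  /-nonNeg j m = ℚ.nonNegative⁻¹ (+ j ℚ./ suc m) {{ℚ.normalize-nonNeg j (suc m)}}

  /-suc : ∀ j m → + suc j ℚ./ suc m ≡ + j ℚ./ suc m ℚ.+ unit m
  /-suc j m = ℚ.toℚᵘ-injective (ℚᵘ.≃-trans (ℚ.toℚᵘ-fromℚᵘ (ℚᵘ.mkℚᵘ (+ suc j) m))
    (ℚᵘ.≃-trans step
    (ℚᵘ.≃-sym (ℚᵘ.≃-trans (ℚ.toℚᵘ-homo-+ (+ j ℚ./ suc m) (unit m))
      (ℚᵘ.+-cong (ℚ.toℚᵘ-fromℚᵘ (ℚᵘ.mkℚᵘ (+ j) m)) (ℚ.toℚᵘ-fromℚᵘ (ℚᵘ.mkℚᵘ (+ 1) m)))))))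
    where
    s : ℤ.ℤ
    s = + suc m
    step : ℚᵘ.mkℚᵘ (+ suc j) m ℚᵘ.≃ ℚᵘ.mkℚᵘ (+ j) m ℚᵘ.+ ℚᵘ.mkℚᵘ (+ 1) m
    step = ℚᵘ.*≡* (trans (cong (ℤ._* (s ℤ.* s)) (cong +_ (ℕ.+-comm 1 j)))
      (trans (sym (ℤ.*-assoc (+ j ℤ.+ + 1) s s))
        (cong (ℤ._* s) (ℤ.*-distribʳ-+ s (+ j) (+ 1)))))

  unit-small : ∀ ε → 0ℚ ℚ.< ε → ∃[ N ] (∀ m → N ℕ.≤ m → unit m ℚ.< ε)
  unit-small ε@(ℚ.mkℚ (+ zero) d _) (ℚ.*<* (ℤ.+<+ ()))
  unit-small ε@(ℚ.mkℚ (+ suc p) d _) _ = suc d , λ m d<m →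
    ℚ.toℚᵘ-cancel-< (ℚᵘ.<-respˡ-≃ (ℚᵘ.≃-sym (ℚ.toℚᵘ-fromℚᵘ (ℚᵘ.mkℚᵘ (+ 1) m)))
      (ℚᵘ.*<* (ℤ.+<+ (ℕ.<-≤-trans
        (subst (ℕ._< suc m) (sym (ℕ.*-identityˡ (suc d))) (ℕ.s≤s d<m))
        (ℕ.m≤m+n (suc m) (p ℕ.* suc m))))))
  unit-small (ℚ.mkℚ ℤ.-[1+ _ ] _ _) (ℚ.*<* ())

  ^-nonNeg : ∀ {a} k → 0ℚ ℚ.≤ a → 0ℚ ℚ.≤ a ^ k
  ^-nonNeg zero    _   = ℚ.nonNegative⁻¹ 1ℚ
  ^-nonNeg (suc k) 0≤a = *-nonNeg 0≤a (^-nonNeg k 0≤a)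

  ^-pos : ∀ {a} k → 0ℚ ℚ.< a → 0ℚ ℚ.< a ^ k
  ^-pos zero    _   = ℚ.positive⁻¹ 1ℚ
  ^-pos (suc k) 0<a = *-pos 0<a (^-pos k 0<a)

  ^-mono-≤ : ∀ {a b} k → 0ℚ ℚ.≤ a → a ℚ.≤ b → a ^ k ℚ.≤ b ^ k
  ^-mono-≤ zero    _   _   = ℚ.≤-refl
  ^-mono-≤ (suc k) 0≤a a≤b =
    *-mono-≤ 0≤a (^-nonNeg k (ℚ.≤-trans 0≤a a≤b)) a≤b (^-mono-≤ k 0≤a a≤b)

  ^-cancel-< : ∀ {a b} k → 0ℚ ℚ.≤ b → a ^ k ℚ.< b ^ k → a ℚ.< b
  ^-cancel-< {a} {b} k 0≤b h with a ℚ.<? b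
  ... | yes a<b = a<b
  ... | no  a≮b = contradiction
    (ℚ.<-≤-trans h (^-mono-≤ k 0≤b (ℚ.≮⇒≥ a≮b))) (ℚ.<-irrefl refl)

  ≤-+ʳ : ∀ {a b} → 0ℚ ℚ.≤ b → a ℚ.≤ a ℚ.+ b
  ≤-+ʳ {a} {b} 0≤b = subst (ℚ._≤ a ℚ.+ b) (ℚ.+-identityʳ a) (ℚ.+-monoʳ-≤ a 0≤b)

  +-nonNeg : ∀ {a b} → 0ℚ ℚ.≤ a → 0ℚ ℚ.≤ b → 0ℚ ℚ.≤ a ℚ.+ b
  +-nonNeg 0≤a 0≤b = ℚ.≤-trans 0≤a (≤-+ʳ 0≤b)

  ^-superadditive : ∀ {a b} k → 0ℚ ℚ.≤ a → 0ℚ ℚ.≤ b →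
    a ^ suc k ℚ.+ b ^ suc k ℚ.≤ (a ℚ.+ b) ^ suc k
  ^-superadditive {a} {b} zero 0≤a 0≤b =
    ℚ.≤-reflexive (sym (ℚ.*-distribʳ-+ 1ℚ a b))
  ^-superadditive {a} {b} (suc k) 0≤a 0≤b = ℚ.≤-trans
    (ℚ.+-mono-≤
      (ℚ.*-monoˡ-≤-nonNeg a {{ℚ.nonNegative 0≤a}} (≤-+ʳ 0≤B))
      (ℚ.*-monoˡ-≤-nonNeg b {{ℚ.nonNegative 0≤b}}
        (subst (B ℚ.≤_) (ℚ.+-comm B A) (≤-+ʳ 0≤A))))
    (subst (ℚ._≤ (a ℚ.+ b) ^ suc (suc k)) (ℚ.*-distribʳ-+ (A ℚ.+ B) a b)
      (ℚ.*-monoˡ-≤-nonNeg (a ℚ.+ b) {{ℚ.nonNegative (+-nonNeg 0≤a 0≤b)}}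
        (^-superadditive k 0≤a 0≤b)))
    where
    A B : ℚ
    A = a ^ suc k
    B = b ^ suc k
    0≤A : 0ℚ ℚ.≤ A
    0≤A = ^-nonNeg (suc k) 0≤a
    0≤B : 0ℚ ℚ.≤ B
    0≤B = ^-nonNeg (suc k) 0≤b

  1≤^ : ∀ {c} k → 1ℚ ℚ.≤ c → 1ℚ ℚ.≤ c ^ k
  1≤^ zero    _   = ℚ.≤-refl
  1≤^ (suc k) 1≤c = *-mono-≤ {1ℚ} (ℚ.nonNegative⁻¹ 1ℚ)
    (^-nonNeg k (ℚ.≤-trans (ℚ.nonNegative⁻¹ 1ℚ) 1≤c)) 1≤c (1≤^ k 1≤c)

  c≤c^ : ∀ {c} k → 1ℚ ℚ.≤ c → c ℚ.≤ c ^ suc k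
  c≤c^ {c} k 1≤c = subst (ℚ._≤ c ^ suc k) (ℚ.*-identityʳ c)
    (ℚ.*-monoˡ-≤-nonNeg c
      {{ℚ.nonNegative (ℚ.≤-trans (ℚ.nonNegative⁻¹ 1ℚ) 1≤c)}} (1≤^ k 1≤c))

  q<1+∣↥q∣ : ∀ q → q ℚ.< + suc ℤ.∣ ℚ.↥ q ∣ ℚ./ 1
  q<1+∣↥q∣ q@(ℚ.mkℚ n d _) = ℚ.toℚᵘ-cancel-<
    (ℚᵘ.<-respʳ-≃ (ℚᵘ.≃-sym (ℚ.toℚᵘ-fromℚᵘ (ℚᵘ.mkℚᵘ (+ suc ℤ.∣ n ∣) 0)))
      (ℚᵘ.*<* (ℤ.≤-<-trans (ℤ.≤-reflexive (ℤ.*-identityʳ n)) (go n))))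
    where
    go : ∀ i → i ℤ.< + suc ℤ.∣ i ∣ ℤ.* + suc d
    go (+ i)      = ℤ.+<+ (ℕ.<-≤-trans (ℕ.n<1+n i) (ℕ.m≤m*n (suc i) (suc d)))
    go ℤ.-[1+ i ] = ℤ.-<+

  grid-bound : ∀ c m → + c ℚ./ 1 ℚ.≤ + suc (suc m ℕ.* c) ℚ./ suc m
  grid-bound c m = ℚ.toℚᵘ-cancel-≤
    (ℚᵘ.≤-respˡ-≃ (ℚᵘ.≃-sym (ℚ.toℚᵘ-fromℚᵘ (ℚᵘ.mkℚᵘ (+ c) 0)))
    (ℚᵘ.≤-respʳ-≃ (ℚᵘ.≃-sym (ℚ.toℚᵘ-fromℚᵘ (ℚᵘ.mkℚᵘ (+ suc (suc m ℕ.* c)) m)))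
      (ℚᵘ.*≤* (ℤ.≤-trans (ℤ.≤-reflexive (sym (ℤ.pos-* c (suc m))))
        (ℤ.≤-trans (ℤ.+≤+ nat) (ℤ.≤-reflexive (sym (ℤ.*-identityʳ (+ suc (suc m ℕ.* c))))))))))
    where
    nat : c ℕ.* suc m ℕ.≤ suc (suc m ℕ.* c)
    nat = subst (ℕ._≤ suc (suc m ℕ.* c)) (ℕ.*-comm (suc m) c) (ℕ.n≤1+n (suc m ℕ.* c))

  1≤1+n : ∀ n → 1ℚ ℚ.≤ + suc n ℚ./ 1
  1≤1+n n = ℚ.toℚᵘ-cancel-≤
    (ℚᵘ.≤-respʳ-≃ (ℚᵘ.≃-sym (ℚ.toℚᵘ-fromℚᵘ (ℚᵘ.mkℚᵘ (+ suc n) 0)))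
      (ℚᵘ.*≤* (ℤ.+≤+ (ℕ.s≤s ℕ.z≤n))))

  if-elim : ∀ {A : Set} (P : ℕ → Set) (d : Dec A) {i j : ℕ} →
    (A → P i) → (¬ A → P j) → P (if does d then i else j)
  if-elim P (yes a) p _ = p a
  if-elim P (no ¬a) _ q = q ¬a

  searchRoot-lower : ∀ k q m b → 0ℚ ℚ.≤ q →
    (+ searchRoot (suc k) q m b ℚ./ suc m) ^ suc k ℚ.≤ q
  searchRoot-lower k q m zero 0≤q = subst (ℚ._≤ q)
    (sym (trans (cong (ℚ._* ((+ 0 ℚ./ suc m) ^ k)) (ℚ.0/n≡0 (suc m)))
      (ℚ.*-zeroˡ ((+ 0 ℚ./ suc m) ^ k)))) 0≤q
  searchRoot-lower k q m (suc b) 0≤q =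
    if-elim (λ j → (+ j ℚ./ suc m) ^ suc k ℚ.≤ q)
      ((+ suc b ℚ./ suc m) ^ suc k ℚ.≤? q)
      (λ p → p) (λ _ → searchRoot-lower k q m b 0≤q)

  searchRoot-upper : ∀ k q m b → q ℚ.< (+ suc b ℚ./ suc m) ^ k →
    q ℚ.< (+ suc (searchRoot k q m b) ℚ./ suc m) ^ k
  searchRoot-upper k q m zero    h = h
  searchRoot-upper k q m (suc b) h =
    if-elim (λ j → q ℚ.< (+ suc j ℚ./ suc m) ^ k)
      ((+ suc b ℚ./ suc m) ^ k ℚ.≤? q)
      (λ _ → h) (λ ¬p → searchRoot-upper k q m b (ℚ.≰⇒> ¬p))

  searchRoot-upper′ : ∀ k q m b → q ℚ.< (+ suc b ℚ./ suc m) ^ k →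
    q ℚ.< (+ searchRoot k q m b ℚ./ suc m ℚ.+ unit m) ^ k
  searchRoot-upper′ k q m b h = subst (λ e → q ℚ.< e ^ k)
    (/-suc (searchRoot k q m b) m) (searchRoot-upper k q m b h)

  q<grid^ : ∀ k q m →
    q ℚ.< (+ suc (suc m ℕ.* suc ℤ.∣ ℚ.↥ q ∣) ℚ./ suc m) ^ suc k
  q<grid^ k q m = ℚ.<-≤-trans (q<1+∣↥q∣ q)
    (ℚ.≤-trans (c≤c^ k 1≤c)
      (^-mono-≤ (suc k) (ℚ.≤-trans (ℚ.nonNegative⁻¹ 1ℚ) 1≤c)
        (grid-bound (suc ℤ.∣ ℚ.↥ q ∣) m)))
    where
    1≤c : 1ℚ ℚ.≤ + suc ℤ.∣ ℚ.↥ q ∣ ℚ./ 1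
    1≤c = 1≤1+n ℤ.∣ ℚ.↥ q ∣

opaque
  unfolding rootApprox

  rootApprox-nonNeg : ∀ k q m → 0ℚ ℚ.≤ rootApprox k q m
  rootApprox-nonNeg k q m = /-nonNeg (searchRoot k q m (suc m ℕ.* suc ℤ.∣ ℚ.↥ q ∣)) m

  rootApprox-lower : ∀ k q m → 0ℚ ℚ.≤ q → rootApprox (suc k) q m ^ suc k ℚ.≤ q
  rootApprox-lower k q m = searchRoot-lower k q m (suc m ℕ.* suc ℤ.∣ ℚ.↥ q ∣)

  rootApprox-upper : ∀ k q m → q ℚ.< (rootApprox (suc k) q m ℚ.+ unit m) ^ suc k
  rootApprox-upper k q m =
    searchRoot-upper′ (suc k) q m (suc m ℕ.* suc ℤ.∣ ℚ.↥ q ∣) (q<grid^ k q m)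

abstract

  unit-nonNeg : ∀ m → 0ℚ ℚ.≤ unit m
  unit-nonNeg m = /-nonNeg 1 m

  root-cauchy : ∀ {x} k → IsCauchy x →
    IsCauchy (λ m → rootApprox (suc k) (x m ℚ.⊔ 0ℚ) m)
  root-cauchy {x} k cx = fromOneSided {λ m → rootApprox (suc k) (x m ℚ.⊔ 0ℚ) m} λ ε 0<ε →
    let η = ½ ℚ.* ε
        0<η = half-pos 0<ε
        N₁ , p = toOneSided {λ n → x n ℚ.⊔ 0ℚ} (⊔-cauchy {x} {λ _ → 0ℚ} cx (const-cauchy 0ℚ)) (η ^ suc k) (^-pos (suc k) 0<η)
        N₂ , u = unit-small η 0<η
    in N₁ ℕ.⊔ N₂ , λ m n N≤m N≤n →
      let q = x n ℚ.⊔ 0ℚ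
          y = rootApprox (suc k) (x m ℚ.⊔ 0ℚ) m
          z = rootApprox (suc k) q n
          0≤z+u = +-nonNeg (rootApprox-nonNeg (suc k) q n) (unit-nonNeg n)
          y<z+u+η : y ℚ.< (z ℚ.+ unit n) ℚ.+ η
          y<z+u+η = ^-cancel-< (suc k) (+-nonNeg 0≤z+u (ℚ.<⇒≤ 0<η))
            (ℚ.≤-<-trans (rootApprox-lower k (x m ℚ.⊔ 0ℚ) m (ℚ.p≤q⊔p (x m) 0ℚ))
              (ℚ.<-≤-trans
                (ℚ.<-trans
                  (p m n (ℕ.m⊔n≤o⇒m≤o N₁ N₂ N≤m) (ℕ.m⊔n≤o⇒m≤o N₁ N₂ N≤n))
                  (ℚ.+-monoˡ-< (η ^ suc k) (rootApprox-upper k q n)))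
                (^-superadditive k 0≤z+u (ℚ.<⇒≤ 0<η))))
      in ℚ.<-trans y<z+u+η
           (subst (ℚ._< z ℚ.+ ε) (sym (ℚ.+-assoc z (unit n) η))
             (ℚ.+-monoʳ-< z (subst (unit n ℚ.+ η ℚ.<_) (half+half ε)
               (ℚ.+-monoˡ-< η (u n (ℕ.m⊔n≤o⇒n≤o N₁ N₂ N≤n))))))

infixl 8 _^1/_

-- The real k-th root of max(x , 0).  The value at k = 0 is a convention.
_^1/_ : ℝ → ℕ → ℝ
x ^1/ zero  = 1ᴿ
x ^1/ suc k = mkℝ (λ m → rootApprox (suc k) (seq x m ℚ.⊔ 0ℚ) m) (root-cauchy {seq x} k (cauchy x))

√_ : ℝ → ℝ
√ x = x ^1/ 2

abstract

  fromℕ-pos : ∀ {n} → 0 ℕ.< n → 0ᴿ <ᴿ fromℕ n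
  fromℕ-pos {suc n} _ = 1ℚ , ℚ.positive⁻¹ 1ℚ , 0 , λ _ _ →
    subst (ℚ._≤ + suc n ℚ./ 1) (sym (ℚ.+-identityˡ 1ℚ)) (1≤1+n n)

  √-pos : ∀ {x} → 0ᴿ <ᴿ x → 0ᴿ <ᴿ √ x
  √-pos {x} (δ , 0<δ , N , p) =
    let N′ , u = unit-small (½ ℚ.* η) (half-pos 0<η)
    in ½ ℚ.* η , half-pos 0<η , N ℕ.⊔ N′ , λ n N≤n →
      let q = seq x n ℚ.⊔ 0ℚ
          y = rootApprox 2 q n
          δ≤q = ℚ.≤-trans (subst (ℚ._≤ seq x n) (ℚ.+-identityˡ δ)
                             (p n (ℕ.m⊔n≤o⇒m≤o N N′ N≤n)))
                  (ℚ.p≤p⊔q (seq x n) 0ℚ)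
          η<y+u : η ℚ.< y ℚ.+ unit n
          η<y+u = ^-cancel-< 2 (+-nonNeg (rootApprox-nonNeg 2 q n) (unit-nonNeg n))
            (ℚ.≤-<-trans (ℚ.≤-trans η²≤δ δ≤q) (rootApprox-upper 1 q n))
          h : ½ ℚ.* η ℚ.+ ½ ℚ.* η ℚ.< y ℚ.+ ½ ℚ.* η
          h = subst (ℚ._< y ℚ.+ ½ ℚ.* η) (sym (half+half η))
                (ℚ.<-trans η<y+u (ℚ.+-monoʳ-< y (u n (ℕ.m⊔n≤o⇒n≤o N N′ N≤n))))
      in subst (ℚ._≤ y) (sym (ℚ.+-identityˡ (½ ℚ.* η)))
           (ℚ.≮⇒≥ λ y<½η → ℚ.<-asym h (ℚ.+-monoˡ-< (½ ℚ.* η) y<½η))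
    where
    η : ℚ
    η = δ ℚ.⊓ 1ℚ
    0<η : 0ℚ ℚ.< η
    0<η with ℚ.≤-total δ 1ℚ
    ... | inj₁ δ≤1 = subst (0ℚ ℚ.<_) (sym (ℚ.p≤q⇒p⊓q≡p δ≤1)) 0<δ
    ... | inj₂ 1≤δ = subst (0ℚ ℚ.<_) (sym (ℚ.p≥q⇒p⊓q≡q 1≤δ)) (ℚ.positive⁻¹ 1ℚ)
    η²≤δ : η ^ 2 ℚ.≤ δ
    η²≤δ = ℚ.≤-trans (ℚ.*-monoˡ-≤-nonNeg η {{ℚ.nonNegative (ℚ.<⇒≤ 0<η)}}
      (subst (ℚ._≤ 1ℚ) (sym (ℚ.*-identityʳ η)) (ℚ.p⊓q≤q δ 1ℚ)))
      (subst (ℚ._≤ δ) (sym (ℚ.*-identityʳ η)) (ℚ.p⊓q≤p δ 1ℚ))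

------------------------------------------------------------------------
-- Complex numbers

record ℂ : Set where
  constructor _+i_
  field
    re im : ℝ

open ℂ public

infix  4 _≃ᶜ_
infixl 6 _+ᶜ_ _-ᶜ_
infixl 7 _*ᶜ_

_≃ᶜ_ : ℂ → ℂ → Set
z ≃ᶜ w = re z ≃ re w × im z ≃ im w

0ᶜ 1ᶜ : ℂ
0ᶜ = 0ᴿ +i 0ᴿ
1ᶜ = 1ᴿ +i 0ᴿ

fromℝ : ℝ → ℂ
fromℝ x = x +i 0ᴿ

_+ᶜ_ _-ᶜ_ _*ᶜ_ : ℂ → ℂ → ℂ
z +ᶜ w = (re z +ᴿ re w) +i (im z +ᴿ im w)
z -ᶜ w = (re z -ᴿ re w) +i (im z -ᴿ im w)
z *ᶜ w = (re z *ᴿ re w -ᴿ im z *ᴿ im w) +i (re z *ᴿ im w +ᴿ im z *ᴿ re w)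

∣_∣ᶜ : ℂ → ℝ
∣ z ∣ᶜ = √ (re z *ᴿ re z +ᴿ im z *ᴿ im z)

IsReal : ℂ → Set
IsReal z = im z ≃ 0ᴿ

------------------------------------------------------------------------
-- Polynomials over ℂ

-- Coefficients in order of increasing degree; trailing zeros are allowed.
ℂ[x] : Set
ℂ[x] = List ℂ

coeff : ℂ[x] → ℕ → ℂ
coeff []      _       = 0ᶜ
coeff (c ∷ _) zero    = c
coeff (_ ∷ f) (suc k) = coeff f k

eval : ℂ[x] → ℂ → ℂ
eval []      z = 0ᶜ
eval (c ∷ f) z = c +ᶜ z *ᶜ eval f z

IsRoot : ℂ[x] → ℂ → Set
IsRoot f z = eval f z ≃ᶜ 0ᶜ

MonicOfDegree : ℕ → ℂ[x] → Set
MonicOfDegree n f = coeff f n ≃ᶜ 1ᶜ × (∀ k → n ℕ.< k → coeff f k ≃ᶜ 0ᶜ)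

HasRealCoefficients : ℂ[x] → Set
HasRealCoefficients f = All IsReal f

-- For f of degree n: f has n distinct complex roots.  These are then all
-- the roots of f, each of multiplicity one.
record Separable (n : ℕ) (f : ℂ[x]) : Set where
  field
    root     : Vector ℂ n
    isRoot   : ∀ i → IsRoot f (root i)
    distinct : ∀ {i j} → i ≢ j → ¬ (root i ≃ᶜ root j)

open Separable public

-- The value at the empty list is a convention.
minimum : List ℝ → ℝ
minimum []           = 0ᴿ
minimum (x ∷ [])     = x
minimum (x ∷ y ∷ xs) = x ⊓ᴿ minimum (y ∷ xs)

-- As the roots are distinct, αᵢ ≠ αⱼ means i ≠ j.
sep : ∀ {n f} → Separable n f → ℝ
sep {n} s = minimum
  (map (λ (i , j) → ∣ root s i -ᶜ root s j ∣ᶜ)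
    (filter (λ (i , j) → ¬? (i Fin.≟ j)) (cartesianProduct (allFin n) (allFin n))))

mahlerMeasure : ∀ {n f} → Separable n f → ℝ
mahlerMeasure s = foldr _*ᴿ_ 1ᴿ (λ i → 1ᴿ ⊔ᴿ ∣ root s i ∣ᶜ)

HasMinimalModulus : ∀ {n f} (s : Separable n f) → Fin n → Set
HasMinimalModulus s i = ∀ j → ∣ root s i ∣ᶜ ≤ᴿ ∣ root s j ∣ᶜ

-- min {2 , 34 / √ n}
constant : (n : ℕ) → 2 ℕ.≤ n → ℝ
constant n 2≤n =
  fromℕ 2 ⊓ᴿ (fromℕ 34 *ᴿ recip (√ fromℕ n) (√-pos {fromℕ n} (fromℕ-pos (ℕ.<-trans ℕ.z<s 2≤n))))

{-# OPTIONS --safe #-}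
module Submission where

-- Discard a root of least modulus.  If two roots had modulus less than sep/2
-- they would be too close, so every other root has modulus at least sep/2 =: h;
-- their product is at most M, which gives the constant 2.  For the constant
-- 34/√n, sort these k = n - 1 points by modulus: j points at mutual distance at
-- least 2h lie in distinct cells of a grid of mesh h, so the j-th modulus squared
-- is at least j h²/16 and the product of squares at least k! (h²/16)ᵏ, which by
-- (k + 1)ᵏ ≤ 3ᵏ k! is at least ((k + 1) h²/48)ᵏ; and 48 ≤ 17² = (34/2)².
--
-- In the second case a nonreal root α of least modulus has its conjugate among
-- the roots, so sep ≤ |α - conj α| ≤ 2|α| and no root has to be discarded.
--
-- Every estimate is made on the m-th rational approximations of the roots, where
-- the order is decidable.  Since ≤ᴿ is ¬¬-stable, the selection of roots and the
-- identification of conj α among them may be argued classically.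

open import Defs
open import Data.Nat.Base using (ℕ; _≤_; _∸_)
open import Data.Product.Base using (_×_; ∃-syntax)
open import Relation.Nullary using (¬_)
open import Algebra.Bundles using (CommutativeRing)
open import Data.Fin.Base as Fin using (Fin; toℕ; inject₁)
import Data.Fin.Properties as Fin
open import Data.Integer.Base as ℤ using ()
open import Data.List.Base
  using (List; []; _∷_; lookup; length; foldr; tabulate; cartesianProduct; allFin; drop)
import Data.List.Properties as List
open import Data.List.Membership.Propositional using (_∈_)
open import Data.List.Membership.Propositional.Properties
  using (∈-lookup; ∈-map⁺; ∈-filter⁺; ∈-cartesianProduct⁺; ∈-allFin)
open import Data.List.Relation.Binary.Permutation.Propositional as ↭ using (_↭_)
open import Data.List.Relation.Binary.Permutation.Propositional.Properties
  using (↭-length; All-resp-↭)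
import Data.List.Relation.Binary.Permutation.Setoid.Properties as ↭ₛ
open import Data.List.Relation.Unary.All as All using (All; []; _∷_)
import Data.List.Relation.Unary.All.Properties as All
open import Data.List.Relation.Unary.AllPairs using (AllPairs; []; _∷_)
import Data.List.Relation.Unary.AllPairs.Properties as AllPairs
open import Data.List.Relation.Unary.Any using (here; there)
open import Data.Nat.Base as ℕ using (zero; suc; _!)
import Data.Nat.Properties as ℕ
import Data.Nat.Solver as ℕ
open import Data.Product.Base using (_,_; ∃₂; proj₁; proj₂)
open import Data.Rational.Base as ℚ using (ℚ; 0ℚ; 1ℚ; ½; _+_; _*_; _-_; -_)
import Data.Rational.Properties as ℚ
open import Data.Rational.Solver using (module +-*-Solver)
open import Data.Sum.Base using (_⊎_; inj₁; inj₂)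
open import Data.Vec.Functional as Vector using (Vector)
open import Level using (0ℓ)
open import Relation.Binary.Core using (Rel)
open import Relation.Binary.Definitions using (Total; Transitive; Symmetric)
open import Relation.Binary.PropositionalEquality
open import Relation.Nullary using (yes; no; contradiction; ¬?)
open import Algebra.Definitions.RawSemiring ℚ.+-*-rawSemiring using (_^_)
open import Algebra.Properties.CommutativeSemiring.Exp
  (CommutativeRing.commutativeSemiring ℚ.+-*-commutativeRing) using (^-distrib-*)

-- A power bound for factorials

-- (1 + 1/N)ᵏ ≤ 1 + k/N + (k/N)² for k ≤ N, with denominators cleared.
binomial-truncation : ∀ N k → k ≤ N →
  N ℕ.* N ℕ.* suc N ℕ.^ k ≤ N ℕ.^ k ℕ.* (N ℕ.* N ℕ.+ k ℕ.* N ℕ.+ k ℕ.* k)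
binomial-truncation N zero    _   = ℕ.≤-reflexive
  (solve 1 (λ N → N :* N :* con 1 := con 1 :* (N :* N :+ con 0 :* N :+ con 0 :* con 0)) refl N)
  where open ℕ.+-*-Solver
binomial-truncation N (suc k) k<N = begin
  N ℕ.* N ℕ.* (suc N ℕ.* P)
    ≡⟨ solve 3 (λ N S P → N :* N :* (S :* P) := S :* (N :* N :* P)) refl N (suc N) P ⟩
  suc N ℕ.* (N ℕ.* N ℕ.* P)
    ≤⟨ ℕ.*-monoʳ-≤ (suc N) (binomial-truncation N k k≤N) ⟩
  suc N ℕ.* (Q ℕ.* (N ℕ.* N ℕ.+ k ℕ.* N ℕ.+ k ℕ.* k))
    ≡⟨ solve 3 (λ N k Q → (con 1 :+ N) :* (Q :* (N :* N :+ k :* N :+ k :* k)) :=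
         Q :* (N :* (N :* N :+ (con 1 :+ k) :* N :+ k :* k) :+ k :* N :+ k :* k)) refl N k Q ⟩
  Q ℕ.* (N ℕ.* (N ℕ.* N ℕ.+ suc k ℕ.* N ℕ.+ k ℕ.* k) ℕ.+ k ℕ.* N ℕ.+ k ℕ.* k)
    -- The estimate `k² ≤ kN + N` supplies what is missing to complete `(k + 1)² N`.
    ≤⟨ ℕ.*-monoʳ-≤ Q (ℕ.+-monoʳ-≤ _ (ℕ.≤-trans (ℕ.*-monoʳ-≤ k k≤N) (ℕ.m≤m+n _ N))) ⟩
  Q ℕ.* (N ℕ.* (N ℕ.* N ℕ.+ suc k ℕ.* N ℕ.+ k ℕ.* k) ℕ.+ k ℕ.* N ℕ.+ (k ℕ.* N ℕ.+ N))
    ≡⟨ solve 3 (λ N k Q → Q :* (N :* (N :* N :+ (con 1 :+ k) :* N :+ k :* k) :+ k :* N :+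
      (k :* N :+ N)) :=
         N :* Q :* (N :* N :+ (con 1 :+ k) :* N :+ (con 1 :+ k) :* (con 1 :+ k))) refl N k Q ⟩
  N ℕ.* Q ℕ.* (N ℕ.* N ℕ.+ suc k ℕ.* N ℕ.+ suc k ℕ.* suc k) ∎
  where
  open ℕ.≤-Reasoning
  open ℕ.+-*-Solver
  P Q : ℕ
  P = suc N ℕ.^ k
  Q = N ℕ.^ k
  k≤N : k ≤ N
  k≤N = ℕ.<⇒≤ k<N

[1+N]^N≤3N^N : ∀ N .{{_ : ℕ.NonZero N}} → suc N ℕ.^ N ≤ 3 ℕ.* N ℕ.^ N
[1+N]^N≤3N^N N@(suc _) = ℕ.*-cancelˡ-≤ (N ℕ.* N) (ℕ.≤-trans (binomial-truncation N N ℕ.≤-refl)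
  (ℕ.≤-reflexive (solve 2 (λ N P → P :* (N :* N :+ N :* N :+ N :* N) := N :* N :* (con 3 :* P))
    refl N (N ℕ.^ N))))
  where open ℕ.+-*-Solver

-- Passing from `m` to `m + 1` multiplies `(m + 1)ᵐ / m!` by the `(m + 1)`-th power of
-- `1 + 1/(m + 1)`, which is at most 3.
[1+m]^m≤3^m*m! : ∀ m → suc m ℕ.^ m ≤ 3 ℕ.^ m ℕ.* m !
[1+m]^m≤3^m*m! zero    = ℕ.≤-refl
[1+m]^m≤3^m*m! (suc m) = begin
  suc (suc m) ℕ.^ suc m                    ≤⟨ [1+N]^N≤3N^N (suc m) ⟩
  3 ℕ.* (suc m ℕ.* suc m ℕ.^ m)
    ≤⟨ ℕ.*-monoʳ-≤ 3 (ℕ.*-monoʳ-≤ (suc m) ([1+m]^m≤3^m*m! m)) ⟩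
  3 ℕ.* (suc m ℕ.* (3 ℕ.^ m ℕ.* m !))
    ≡⟨ solve 3 (λ s a b → con 3 :* (s :* (a :* b)) := con 3 :* a :* (s :* b))
      refl (suc m) (3 ℕ.^ m) (m !) ⟩
  3 ℕ.* 3 ℕ.^ m ℕ.* (suc m ℕ.* m !)        ∎
  where
  open ℕ.≤-Reasoning
  open ℕ.+-*-Solver

-- Natural numbers as rationals

ι : ℕ → ℚ
ι n = ℤ.+ n ℚ./ 1

ι-suc : ∀ n → ι (suc n) ≡ ι n + 1ℚ
ι-suc n = /-suc n 0

ι-nonNeg : ∀ n → 0ℚ ℚ.≤ ι n
ι-nonNeg n = /-nonNeg n 0

ι-homo-+ : ∀ m n → ι (m ℕ.+ n) ≡ ι m + ι n
ι-homo-+ zero    n = sym (ℚ.+-identityˡ (ι n))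
ι-homo-+ (suc m) n = begin
  ι (suc (m ℕ.+ n))       ≡⟨ ι-suc (m ℕ.+ n) ⟩
  ι (m ℕ.+ n) + 1ℚ        ≡⟨ cong (_+ 1ℚ) (ι-homo-+ m n) ⟩
  ι m + ι n + 1ℚ      ≡⟨ solve 2 (λ a b → a :+ b :+ con 1ℚ := a :+ con 1ℚ :+ b) refl (ι m) (ι n) ⟩
  ι m + 1ℚ + ι n      ≡⟨ cong (_+ ι n) (ι-suc m) ⟨
  ι (suc m) + ι n       ∎
  where
  open ≡-Reasoning
  open +-*-Solver

ι-homo-* : ∀ m n → ι (m ℕ.* n) ≡ ι m * ι n
ι-homo-* zero    n = sym (ℚ.*-zeroˡ (ι n))
ι-homo-* (suc m) n = begin
  ι (n ℕ.+ m ℕ.* n)        ≡⟨ ι-homo-+ n (m ℕ.* n) ⟩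
  ι n + ι (m ℕ.* n)      ≡⟨ cong (ι n +_) (ι-homo-* m n) ⟩
  ι n + ι m * ι n    ≡⟨ solve 2 (λ a b → b :+ a :* b := (a :+ con 1ℚ) :* b) refl (ι m) (ι n) ⟩
  (ι m + 1ℚ) * ι n     ≡⟨ cong (_* ι n) (ι-suc m) ⟨
  ι (suc m) * ι n        ∎
  where
  open ≡-Reasoning
  open +-*-Solver

ι-homo-^ : ∀ m k → ι (m ℕ.^ k) ≡ ι m ^ k
ι-homo-^ m zero    = refl
ι-homo-^ m (suc k) = trans (ι-homo-* m (m ℕ.^ k)) (cong (ι m *_) (ι-homo-^ m k))

ι-mono-≤ : ∀ {m n} → m ≤ n → ι m ℚ.≤ ι n
ι-mono-≤ {m} {n} m≤n = subst (λ k → ι m ℚ.≤ ι k) (ℕ.m+[n∸m]≡n m≤n)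
  (subst (ι m ℚ.≤_) (sym (ι-homo-+ m (n ∸ m))) (≤-+ʳ (ι-nonNeg (n ∸ m))))

-- Packing

-- The difference `d` is a certificate: the equation goes to the ring solver, and only the sign of
-- `d` needs an argument.
≤-by : ∀ {a b} d → a + d ≡ b → 0ℚ ℚ.≤ d → a ℚ.≤ b
≤-by {a} d a+d≡b 0≤d = subst (a ℚ.≤_) a+d≡b (≤-+ʳ 0≤d)

<-by : ∀ {a b} d → a + d ≡ b → 0ℚ ℚ.< d → a ℚ.< b
<-by {a} d a+d≡b 0<d = subst (a ℚ.<_) a+d≡b (subst (ℚ._< a + d) (ℚ.+-identityʳ a)
  (ℚ.+-monoʳ-< a 0<d))

p≤q⇒0≤q-p : ∀ {p q} → p ℚ.≤ q → 0ℚ ℚ.≤ q - p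
p≤q⇒0≤q-p {p} {q} p≤q = subst (ℚ._≤ q - p) (ℚ.+-inverseʳ p) (ℚ.+-monoˡ-≤ (- p) p≤q)

p<q⇒0<q-p : ∀ {p q} → p ℚ.< q → 0ℚ ℚ.< q - p
p<q⇒0<q-p {p} {q} p<q = subst (ℚ._< q - p) (ℚ.+-inverseʳ p) (ℚ.+-monoˡ-< (- p) p<q)

+-swapˡ : ∀ a b → a + (b - a) ≡ b
+-swapˡ = solve 2 (λ a b → a :+ (b :- a) := b) refl
  where open +-*-Solver

0≤p*p : ∀ p → 0ℚ ℚ.≤ p * p
0≤p*p p with ℚ.≤-total 0ℚ p
... | inj₁ 0≤p = *-nonNeg 0≤p 0≤p
... | inj₂ p≤0 = subst (0ℚ ℚ.≤_) (solve 1 (λ p → (con 0ℚ :- p) :* (con 0ℚ :- p) := p :* p) refl p)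
                   (*-nonNeg (p≤q⇒0≤q-p p≤0) (p≤q⇒0≤q-p p≤0))
  where open +-*-Solver

p*p<q*q⇒p<q : ∀ {p q} → 0ℚ ℚ.≤ q → p * p ℚ.< q * q → p ℚ.< q
p*p<q*q⇒p<q {p} {q} 0≤q h with p ℚ.<? q
... | yes p<q = p<q
... | no  p≮q = contradiction (ℚ.<-≤-trans h (*-mono-≤ 0≤q
  (ℚ.≤-trans 0≤q q≤p) q≤p q≤p)) (ℚ.<-irrefl refl)
  where
  q≤p : q ℚ.≤ p
  q≤p = ℚ.≮⇒≥ p≮q

p*p<q*q⇒-q<p : ∀ {p q} → 0ℚ ℚ.≤ q → p * p ℚ.< q * q → 0ℚ ℚ.< p + q
p*p<q*q⇒-q<p {p} {q} 0≤q h = subst (0ℚ ℚ.<_)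
  (solve 2 (λ p q → q :- (:- p) := p :+ q) refl p q)
  (p<q⇒0<q-p (p*p<q*q⇒p<q 0≤q (subst (ℚ._< q * q) (solve 1 (λ p → p :* p :=
    (:- p) :* (:- p)) refl p) h)))
  where open +-*-Solver

[p-q]²<h² : ∀ {p q h} → p ℚ.< q + h → q ℚ.< p + h → (p - q) * (p - q) ℚ.< h * h
[p-q]²<h² {p} {q} {h} p< q< = <-by ((q + h - p) * (p + h - q))
  (solve 3 (λ p q h → (p :- q) :* (p :- q) :+ (q :+ h :- p) :* (p :+ h :- q) := h :* h) refl p q h)
  (*-pos (p<q⇒0<q-p p<) (p<q⇒0<q-p q<))
  where open +-*-Solver

∏ : ∀ {A : Set} → (A → ℚ) → List A → ℚ
∏ f = foldr (λ x p → f x * p) 1ℚ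

∏-↭ : ∀ {A : Set} (f : A → ℚ) {xs ys} → xs ↭ ys → ∏ f xs ≡ ∏ f ys
∏-↭ f ↭.refl            = refl
∏-↭ f (↭.prep x p)      = cong (f x *_) (∏-↭ f p)
∏-↭ f (↭.swap {xs} {ys} x y p) = trans
  (solve 3 (λ a b c → a :* (b :* c) := b :* (a :* c)) refl (f x) (f y) (∏ f xs))
  (cong (λ c → f y * (f x * c)) (∏-↭ f p))
  where open +-*-Solver
∏-↭ f (↭.trans p q)     = trans (∏-↭ f p) (∏-↭ f q)

AllPairs-resp-↭ : ∀ {A : Set} {R : Rel A 0ℓ} → Symmetric R →
  ∀ {xs ys} → xs ↭ ys → AllPairs R xs → AllPairs R ys
AllPairs-resp-↭ {A} {R} R-sym p =
  ↭ₛ.AllPairs-resp-↭ (setoid A) R-sym ((λ { refl r → r }) , (λ { refl r → r })) (↭.↭⇒↭ₛ p)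

lookup-AllPairs : ∀ {A : Set} {R : Rel A 0ℓ} {xs} → AllPairs R xs →
  ∀ {i j} → i Fin.< j → R (lookup xs i) (lookup xs j)
lookup-AllPairs (r ∷ _)  {Fin.zero}  {Fin.suc j} _         = All.lookup r (∈-lookup j)
lookup-AllPairs (_ ∷ rs) {Fin.suc i} {Fin.suc j} (ℕ.s≤s i<j) = lookup-AllPairs rs i<j

-- Serves for points of largest and of smallest modulus alike. The remaining points are given up to
-- permutation, under which products and pairwise conditions are invariant.
extract-extremum : ∀ {A : Set} (R : Rel A 0ℓ) → Total R → Transitive R →
  ∀ x xs → ∃₂ λ y ys → x ∷ xs ↭ y ∷ ys × All (R y) ys
extract-extremum R total R-trans x []        = x , [] , ↭.refl , []
extract-extremum R total R-trans x (x′ ∷ xs) with extract-extremum R total R-trans x′ xs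
... | y , ys , p , y-ext with total x y
...   | inj₁ Rxy = x , y ∷ ys , ↭.prep x p , Rxy ∷ All.map (R-trans Rxy) y-ext
...   | inj₂ Ryx = y , x ∷ ys , ↭.trans (↭.prep x p) (↭.swap x y ↭.refl) , Ryx ∷ y-ext

Point : Set
Point = ℚ × ℚ

∥_∥² : Point → ℚ
∥ a , b ∥² = a * a + b * b

distSq : Point → Point → ℚ
distSq (a , b) (c , d) = ∥ a - c , b - d ∥²

∥∥²-nonNeg : ∀ z → 0ℚ ℚ.≤ ∥ z ∥²
∥∥²-nonNeg (a , b) = +-nonNeg (0≤p*p a) (0≤p*p b)

-- For h > 0: at distance at least 2h.
Apart : ℚ → Rel Point 0ℓ
Apart h z w = ι 4 * (h * h) ℚ.≤ distSq z w

Apart-sym : ∀ {h} → Symmetric (Apart h)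
Apart-sym {h} {a , b} {c , d} = subst (ι 4 * (h * h) ℚ.≤_)
  (solve 4 (λ a b c d → (a :- c) :* (a :- c) :+ (b :- d) :* (b :- d) :=
     (c :- a) :* (c :- a) :+ (d :- b) :* (d :- b)) refl a b c d)
  where open +-*-Solver

-- The index is the integer part of `q / h`, found by descending from the bound `B`.
cell : ∀ B {h q} → 0ℚ ℚ.≤ q → q ℚ.< ι B * h →
  ∃[ k ] (ι (toℕ {B} k) * h ℚ.≤ q × q ℚ.< ι (toℕ k) * h + h)
cell zero    {h} {q} 0≤q q< = contradiction
  (ℚ.≤-<-trans 0≤q (subst (q ℚ.<_) (ℚ.*-zeroˡ h) q<)) (ℚ.<-irrefl refl)
cell (suc B) {h} {q} 0≤q q< with q ℚ.<? ι B * h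
... | yes q<Bh with cell B 0≤q q<Bh
...   | k , lo , hi = inject₁ k
  , subst (λ j → ι j * h ℚ.≤ q) (sym (Fin.toℕ-inject₁ k)) lo
  , subst (λ j → q ℚ.< ι j * h + h) (sym (Fin.toℕ-inject₁ k)) hi
cell (suc B) {h} {q} 0≤q q< | no q≮Bh = Fin.fromℕ B
  , subst (λ j → ι j * h ℚ.≤ q) (sym (Fin.toℕ-fromℕ B)) (ℚ.≮⇒≥ q≮Bh)
  , subst (λ j → q ℚ.< ι j * h + h) (sym (Fin.toℕ-fromℕ B))
      (subst (q ℚ.<_) (trans (cong (_* h) (ι-suc B))
        (solve 2 (λ b h → (b :+ con 1ℚ) :* h := b :* h :+ h) refl (ι B) h)) q<)
  where open +-*-Solver

-- For m > 16, the least K with √m/4 ≤ K also satisfies K < √m/2,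
-- so that the (2K)² cells of the square of half-side K h are fewer than m.
least-grid : ∀ B {m} → m ≤ 16 ℕ.* (B ℕ.* B) → 16 ℕ.< m →
  ∃[ K ] (m ≤ 16 ℕ.* (K ℕ.* K) × 4 ℕ.* (K ℕ.* K) ℕ.< m)
least-grid zero    m≤ 16<m = contradiction (ℕ.<-≤-trans 16<m m≤) λ ()
least-grid (suc B) {m} m≤ 16<m with m ℕ.≤? 16 ℕ.* (B ℕ.* B)
... | yes m≤16B² = least-grid B m≤16B² 16<m
... | no  m≰16B² = suc B , m≤ , 4[1+B]²<m B (ℕ.≰⇒> m≰16B²)
  where
  -- If `B` fails then `16 B² < m`, and `4 (B + 1)² ≤ 16 B²` once `B ≥ 1`. For `B = 0` the left side
  -- is 4, and `m > 16` suffices.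
  4[1+B]²<m : ∀ B → 16 ℕ.* (B ℕ.* B) ℕ.< m → 4 ℕ.* (suc B ℕ.* suc B) ℕ.< m
  4[1+B]²<m zero    _      = ℕ.≤-trans (ℕ.m≤m+n 5 12) 16<m
  4[1+B]²<m (suc B) 16B²<m = ℕ.≤-<-trans (ℕ.≤-trans (ℕ.m≤m+n _ _) (ℕ.≤-reflexive
    (solve 1 (λ B → con 4 :* ((con 2 :+ B) :* (con 2 :+ B)) :+ (con 12 :*
      (B :* B) :+ con 16 :* B) :=
       con 16 :* ((con 1 :+ B) :* (con 1 :+ B))) refl B))) 16B²<m
    where open ℕ.+-*-Solver

-- Each coordinate difference is below `h` in absolute value, so the squared distance is below
-- `2h²`, while being apart demands `4h²`.
same-cell⇒¬Apart : ∀ {h c u v} z w → 0ℚ ℚ.< h →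
  u ℚ.≤ proj₁ z + c → proj₁ z + c ℚ.< u + h → u ℚ.≤ proj₁ w + c → proj₁ w + c ℚ.< u + h →
  v ℚ.≤ proj₂ z + c → proj₂ z + c ℚ.< v + h → v ℚ.≤ proj₂ w + c → proj₂ w + c ℚ.< v + h →
  ¬ Apart h z w
same-cell⇒¬Apart {h} {c} (a , b) (a′ , b′) 0<h u≤a a<u u≤a′ a′<u v≤b b<v v≤b′ b′<v apart =
  ℚ.<-irrefl refl (ℚ.≤-<-trans apart (ℚ.<-≤-trans
    (ℚ.+-mono-< (close a a′ u≤a a<u u≤a′ a′<u) (close b b′ v≤b b<v v≤b′ b′<v))
    (≤-by (ι 2 * (h * h)) (solve 1 (λ h → h :* h :+ h :* h :+ con (ι 2) :* (h :* h) :=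
      con (ι 4) :* (h :* h)) refl h)
      (*-nonNeg (ι-nonNeg 2) (0≤p*p h)))))
  where
  open +-*-Solver
  shift : ∀ x y u → u ℚ.≤ y + c → x + c ℚ.< u + h → x ℚ.< y + h
  shift x y u u≤ x< = <-by (y + h - x) (+-swapˡ x (y + h))
    (subst (0ℚ ℚ.<_) (solve 4 (λ x y c h → y :+ c :+ h :- (x :+ c) := y :+ h :- x) refl x y c h)
      (p<q⇒0<q-p (ℚ.<-≤-trans x< (ℚ.+-monoˡ-≤ h u≤))))
  close : ∀ x y {u} → u ℚ.≤ x + c → x + c ℚ.< u + h → u ℚ.≤ y + c → y + c ℚ.< u + h →
    (x - y) * (x - y) ℚ.< h * h
  close x y {u} u≤x x<u u≤y y<u = [p-q]²<h² (shift x y u u≤y x<u) (shift y x u u≤x y<u)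

-- Coordinates are shifted by c, the half-side of the square, to be nonnegative.
InCell : ℚ → ℚ → ℚ → ℕ → Set
InCell h c x k = ι k * h ℚ.≤ x + c × x + c ℚ.< ι k * h + h

coordinate-cell : ∀ K {h x} → 0ℚ ℚ.< h → x * x ℚ.< ι K * h * (ι K * h) →
  ∃[ k ] InCell h (ι K * h) x (toℕ {K ℕ.+ K} k)
coordinate-cell K {h} {x} 0<h x²<c² =
  cell (K ℕ.+ K) {h} (ℚ.<⇒≤ (p*p<q*q⇒-q<p {x} 0≤c x²<c²))
    (subst (x + ι K * h ℚ.<_)
      (trans (solve 2 (λ k h → k :* h :+ k :* h := (k :+ k) :* h) refl (ι K) h)
        (cong (_* h) (sym (ι-homo-+ K K))))
      (ℚ.+-monoˡ-< (ι K * h) (p*p<q*q⇒p<q {x} 0≤c x²<c²)))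
  where
  open +-*-Solver
  0≤c : 0ℚ ℚ.≤ ι K * h
  0≤c = *-nonNeg (ι-nonNeg K) (ℚ.<⇒≤ 0<h)

pigeonhole² : ∀ {k l m} → k ℕ.* l ℕ.< m → (f : Fin m → Fin k) (g : Fin m → Fin l) →
  ∃₂ λ i j → i Fin.< j × f i ≡ f j × g i ≡ g j
pigeonhole² kl<m f g with Fin.pigeonhole kl<m (λ i → Fin.combine (f i) (g i))
... | i , j , i<j , same = i , j , i<j , Fin.combine-injective (f i) (g i) (f j) (g j) same

-- The disk of radius `K h` lies in a square of side `2K h`, which splits into `(2K)²` half-open
-- cells of side `h`; with more points than cells, two would share one.
square-packing : ∀ K {h} xs → 0ℚ ℚ.< h → AllPairs (Apart h) xs →
  All (λ z → ∥ z ∥² ℚ.< ι K * h * (ι K * h)) xs → length xs ≤ (K ℕ.+ K) ℕ.* (K ℕ.+ K)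
square-packing K {h} xs 0<h apart bounded =
  ℕ.≮⇒≥ λ many → collide (λ i → re-cell (lookup xs i) (small i))
    (λ i → im-cell (lookup xs i) (small i)) many
  where
  c : ℚ
  c = ι K * h
  small : ∀ i → ∥ lookup xs i ∥² ℚ.< c * c
  small i = All.lookup bounded (∈-lookup {xs = xs} i)
  re-cell : ∀ z → ∥ z ∥² ℚ.< c * c → ∃[ k ] InCell h c (proj₁ z) (toℕ {K ℕ.+ K} k)
  re-cell (a , b) z< = coordinate-cell K {x = a} 0<h (ℚ.≤-<-trans (≤-+ʳ (0≤p*p b)) z<)
  im-cell : ∀ z → ∥ z ∥² ℚ.< c * c → ∃[ k ] InCell h c (proj₂ z) (toℕ {K ℕ.+ K} k)
  im-cell (a , b) z< = coordinate-cell K {x = b} 0<h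
    (ℚ.≤-<-trans (≤-by (a * a) (ℚ.+-comm (b * b) (a * a)) (0≤p*p a)) z<)
  same-cell : ∀ z w {k k′ l l′ : Fin (K ℕ.+ K)} → k ≡ k′ → l ≡ l′ →
    InCell h c (proj₁ z) (toℕ k) → InCell h c (proj₁ w) (toℕ k′) →
    InCell h c (proj₂ z) (toℕ l) → InCell h c (proj₂ w) (toℕ l′) → ¬ Apart h z w
  same-cell z w {k} {_} {l} refl refl (u≤ , <u) (u≤′ , <u′) (v≤ , <v) (v≤′ , <v′) =
    same-cell⇒¬Apart {h} {c} {ι (toℕ k) * h} {ι (toℕ l) * h} z w 0<h u≤ <u u≤′ <u′ v≤ <v v≤′ <v′
  collide : (∀ i → ∃[ k ] InCell h c (proj₁ (lookup xs i)) (toℕ {K ℕ.+ K} k)) →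
            (∀ i → ∃[ l ] InCell h c (proj₂ (lookup xs i)) (toℕ {K ℕ.+ K} l)) →
            ¬ (K ℕ.+ K) ℕ.* (K ℕ.+ K) ℕ.< length xs
  collide re im many = clash (pigeonhole² many (λ i → proj₁ (re i)) (λ i → proj₁ (im i)))
    where
    clash : ¬ ∃₂ λ i j → i Fin.< j × proj₁ (re i) ≡ proj₁ (re j) × proj₁ (im i) ≡ proj₁ (im j)
    clash (i , j , i<j , same-re , same-im) =
      same-cell (lookup xs i) (lookup xs j) same-re same-im
        (proj₂ (re i)) (proj₂ (re j)) (proj₂ (im i)) (proj₂ (im j))
        (lookup-AllPairs {R = Apart h} {xs} apart i<j)

-- Up to 16 points the hypothesis `h² ≤ ρ` is enough. For `m > 16` points, `16 ρ < m h²` would put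
-- the disk inside a square of half-side `K h` with `m ≤ 16 K²`, which holds at most `4 K² < m`
-- points.
disk-packing : ∀ {h ρ} xs → 0ℚ ℚ.< h → AllPairs (Apart h) xs →
  All (λ z → ∥ z ∥² ℚ.≤ ρ) xs → h * h ℚ.≤ ρ → ι (length xs) * (h * h) ℚ.≤ ι 16 * ρ
disk-packing {h} {ρ} xs 0<h apart bounded h²≤ρ with length xs ℕ.≤? 16
... | yes m≤16 = *-mono-≤ {ι (length xs)} {ι 16} {h * h} {ρ} (ι-nonNeg (length xs))
  (ℚ.≤-trans (0≤p*p h) h²≤ρ) (ι-mono-≤ m≤16) h²≤ρ
... | no  m≰16 = ℚ.≮⇒≥ λ 16ρ<mh² → ℕ.<⇒≱ 4K²<m (subst (length xs ≤_) ([2K]²≡4K² K)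
  (square-packing K xs 0<h apart (All.map (λ {z} z≤ρ → ℚ.≤-<-trans z≤ρ (ρ<c² 16ρ<mh²)) bounded)))
  where
  m≤16m² : ∀ m → m ≤ 16 ℕ.* (m ℕ.* m)
  m≤16m² zero      = ℕ.z≤n
  m≤16m² m@(suc _) = ℕ.≤-trans (ℕ.m≤m*n m m) (ℕ.m≤n*m (m ℕ.* m) 16)
  [2K]²≡4K² : ∀ K → (K ℕ.+ K) ℕ.* (K ℕ.+ K) ≡ 4 ℕ.* (K ℕ.* K)
  [2K]²≡4K² = solve 1 (λ K → (K :+ K) :* (K :+ K) := con 4 :* (K :* K)) refl
    where open ℕ.+-*-Solver
  grid : ∃[ K ] (length xs ≤ 16 ℕ.* (K ℕ.* K) × 4 ℕ.* (K ℕ.* K) ℕ.< length xs)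
  -- The search may start from the number `m` of points itself, as `m ≤ 16 m²`.
  grid = least-grid (length xs) (m≤16m² (length xs)) (ℕ.≰⇒> m≰16)
  K : ℕ
  K = proj₁ grid
  4K²<m : 4 ℕ.* (K ℕ.* K) ℕ.< length xs
  4K²<m = proj₂ (proj₂ grid)
  16K²h² : ι (16 ℕ.* (K ℕ.* K)) * (h * h) ≡ ι 16 * (ι K * h * (ι K * h))
  16K²h² = trans (cong (_* (h * h)) (trans (ι-homo-* 16 (K ℕ.* K)) (cong (ι 16 *_) (ι-homo-* K K))))
    (solve 3 (λ s k h → s :* (k :* k) :* (h :* h) := s :* (k :* h :* (k :* h))) refl (ι 16) (ι K) h)
    where open +-*-Solver
  ρ<c² : ι 16 * ρ ℚ.< ι (length xs) * (h * h) → ρ ℚ.< ι K * h * (ι K * h)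
  ρ<c² 16ρ<mh² = ℚ.*-cancelˡ-<-nonNeg (ι 16) {{ℚ.nonNegative (ι-nonNeg 16)}}
    (ℚ.<-≤-trans 16ρ<mh² (subst (ι (length xs) * (h * h) ℚ.≤_) 16K²h²
      (ℚ.*-monoʳ-≤-nonNeg (h * h) {{ℚ.nonNegative (0≤p*p h)}} (ι-mono-≤ (proj₁ (proj₂ grid))))))

-- Lower bounds for products of moduli

-- Induction by removing a point `y` of largest modulus: all `m + 1` points lie in the disk of
-- radius `|y|`, so packing gives `(m + 1) h² ≤ 16 |y|²`, and these factors multiply up to the
-- factorial.
∏-lower : ∀ {h} m xs → length xs ≡ m → 0ℚ ℚ.< h → AllPairs (Apart h) xs →
  All (λ z → h * h ℚ.≤ ∥ z ∥²) xs → ι (m !) * (h * h) ^ m ℚ.≤ ι 16 ^ m * ∏ ∥_∥² xs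
∏-lower zero    []       _   _   _     _   = ℚ.≤-refl
∏-lower {h} (suc m) (x ∷ xs) len 0<h apart far = step
  -- The relation is reversed, so the extremum is a point of largest modulus.
  (extract-extremum (λ y z → ∥ z ∥² ℚ.≤ ∥ y ∥²) (λ y z → ℚ.≤-total ∥ z ∥² ∥ y ∥²)
    (λ z≤y w≤z → ℚ.≤-trans w≤z z≤y) x xs)
  where
  step : (∃₂ λ y ys → x ∷ xs ↭ y ∷ ys × All (λ z → ∥ z ∥² ℚ.≤ ∥ y ∥²) ys) →
    ι (suc m !) * (h * h) ^ suc m ℚ.≤ ι 16 ^ suc m * ∏ ∥_∥² (x ∷ xs)
  step (y , ys , perm , y-max) with AllPairs-resp-↭ (λ {z} {w} → Apart-sym {h} {z} {w}) perm apart
                                   | All-resp-↭ perm far | trans (sym (↭-length perm)) len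
  ... | apart′@(_ ∷ apart-ys) | h≤y ∷ h≤ys | len′ =
    subst₂ ℚ._≤_ left right
      (*-mono-≤ {ι (suc m) * (h * h)} {ι 16 * ∥ y ∥²} {ι (m !) * (h * h) ^ m} {ι 16 ^ m * ∏ ∥_∥² ys}
      (*-nonNeg (ι-nonNeg (suc m)) (0≤p*p h))
      (ℚ.≤-trans (*-nonNeg (ι-nonNeg (m !)) (^-nonNeg m (0≤p*p h))) ih)
      (subst (λ l → ι l * (h * h) ℚ.≤ ι 16 * ∥ y ∥²) len′
        (disk-packing (y ∷ ys) 0<h apart′ (ℚ.≤-refl ∷ y-max) h≤y))
      ih)
    where
    open +-*-Solver
    ih : ι (m !) * (h * h) ^ m ℚ.≤ ι 16 ^ m * ∏ ∥_∥² ys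
    ih = ∏-lower m ys (ℕ.suc-injective len′) 0<h apart-ys h≤ys
    left : ι (suc m) * (h * h) * (ι (m !) * (h * h) ^ m) ≡ ι (suc m !) * (h * h) ^ suc m
    left = trans (solve 4 (λ a b c d → a :* b :* (c :* d) := a :* c :* (b :* d))
      refl (ι (suc m)) (h * h) (ι (m !)) ((h * h) ^ m))
      (cong (_* (h * h) ^ suc m) (sym (ι-homo-* (suc m) (m !))))
    right : ι 16 * ∥ y ∥² * (ι 16 ^ m * ∏ ∥_∥² ys) ≡ ι 16 ^ suc m * ∏ ∥_∥² (x ∷ xs)
    right = trans (solve 4 (λ a b c d → a :* b :* (c :* d) := a :* c :* (b :* d))
      refl (ι 16) ∥ y ∥² (ι 16 ^ m) (∏ ∥_∥² ys))
      (cong (ι 16 ^ suc m *_) (sym (∏-↭ ∥_∥² perm)))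

∏-lower-trivial : ∀ {h} xs → All (λ z → h * h ℚ.≤ ∥ z ∥²) xs → (h * h) ^ length xs ℚ.≤ ∏ ∥_∥² xs
∏-lower-trivial     []       []          = ℚ.≤-refl
∏-lower-trivial {h} (x ∷ xs) (h≤x ∷ far) = *-mono-≤ (0≤p*p h)
  (ℚ.≤-trans (^-nonNeg (length xs) (0≤p*p h)) rest) h≤x rest
  where
  rest : (h * h) ^ length xs ℚ.≤ ∏ ∥_∥² xs
  rest = ∏-lower-trivial {h} xs far

-- Replaces the factorial by an `m`-th power, of which a root can be taken; the constant is
-- `48 = 3 · 16`. The base is `m + 1` because `m = n - 1` points remain once a root is dropped.
∏-lower-Stirling : ∀ {h} xs → 0ℚ ℚ.< h → AllPairs (Apart h) xs → All (λ z → h * h ℚ.≤ ∥ z ∥²) xs →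
  (h * h * ι (suc (length xs))) ^ length xs ℚ.≤ ι 48 ^ length xs * ∏ ∥_∥² xs
∏-lower-Stirling {h} xs 0<h apart far = begin
  (h * h * ι (suc m)) ^ m                   ≡⟨ ^-distrib-* (h * h) (ι (suc m)) m ⟩
  (h * h) ^ m * ι (suc m) ^ m               ≡⟨ cong ((h * h) ^ m *_) (sym (ι-homo-^ (suc m) m)) ⟩
  (h * h) ^ m * ι (suc m ℕ.^ m)
    ≤⟨ ℚ.*-monoˡ-≤-nonNeg ((h * h) ^ m) {{ℚ.nonNegative (^-nonNeg m (0≤p*p h))}}
      (ι-mono-≤ ([1+m]^m≤3^m*m! m)) ⟩
  (h * h) ^ m * ι (3 ℕ.^ m ℕ.* m !)
    ≡⟨ cong ((h * h) ^ m *_) (trans (ι-homo-* (3 ℕ.^ m) (m !)) (cong (_* ι (m !)) (ι-homo-^ 3 m))) ⟩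
  (h * h) ^ m * (ι 3 ^ m * ι (m !))
    ≡⟨ solve 3 (λ a b c → a :* (b :* c) := b :* (c :* a)) refl ((h * h) ^ m) (ι 3 ^ m) (ι (m !)) ⟩
  ι 3 ^ m * (ι (m !) * (h * h) ^ m)
    ≤⟨ ℚ.*-monoˡ-≤-nonNeg (ι 3 ^ m) {{ℚ.nonNegative (^-nonNeg m (ι-nonNeg 3))}}
      (∏-lower m xs refl 0<h apart far) ⟩
  ι 3 ^ m * (ι 16 ^ m * ∏ ∥_∥² xs)          ≡⟨ ℚ.*-assoc (ι 3 ^ m) (ι 16 ^ m) (∏ ∥_∥² xs) ⟨
  ι 3 ^ m * ι 16 ^ m * ∏ ∥_∥² xs
    ≡⟨ cong (_* ∏ ∥_∥² xs) (sym (^-distrib-* (ι 3) (ι 16) m)) ⟩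
  ι 48 ^ m * ∏ ∥_∥² xs                      ∎
  where
  open ℚ.≤-Reasoning
  open +-*-Solver
  m : ℕ
  m = length xs

-- Superadditivity of powers, applied to `b = a + (b - a)`.
^-mono-< : ∀ {a b} k → 0ℚ ℚ.≤ a → a ℚ.< b → a ^ suc k ℚ.< b ^ suc k
^-mono-< {a} {b} k 0≤a a<b = ℚ.<-≤-trans
  (<-by ((b - a) ^ suc k) refl (^-pos (suc k) (p<q⇒0<q-p a<b)))
  (subst (λ c → a ^ suc k + (b - a) ^ suc k ℚ.≤ c ^ suc k) (+-swapˡ a b)
    (^-superadditive k 0≤a (ℚ.<⇒≤ (p<q⇒0<q-p a<b))))

^-cancel-≤ : ∀ {a b} k → 0ℚ ℚ.≤ b → a ^ suc k ℚ.≤ b ^ suc k → a ℚ.≤ b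
^-cancel-≤ k 0≤b h = ℚ.≮⇒≥ λ b<a → ℚ.<-irrefl refl (ℚ.<-≤-trans (^-mono-< k 0≤b b<a) h)

p*p≤q*q⇒p≤q : ∀ {p q} → 0ℚ ℚ.≤ q → p * p ℚ.≤ q * q → p ℚ.≤ q
p*p≤q*q⇒p≤q {p} {q} 0≤q h = ^-cancel-≤ 1 0≤q
  (subst₂ ℚ._≤_ (cong (p *_) (sym (ℚ.*-identityʳ p))) (cong (q *_) (sym (ℚ.*-identityʳ q))) h)

-- Both lower bounds for the product, followed by `(k + 1)`-th roots and square roots. Here `h` is
-- half the separation, `Y` stands for the root of the Mahler measure and `r` for `√n`, so the
-- constants 1 and 17 become 2 and 34 after doubling.
separation-bound : ∀ {h Y r} k xs → length xs ≡ suc k → 0ℚ ℚ.< h → 0ℚ ℚ.≤ Y →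
  AllPairs (Apart h) xs → All (λ z → h * h ℚ.≤ ∥ z ∥²) xs → ∏ ∥_∥² xs ℚ.≤ (Y * Y) ^ suc k →
  r * r ℚ.≤ ι (suc (suc k)) → h ℚ.≤ Y × h * r ℚ.≤ ι 17 * Y
separation-bound {h} {Y} {r} k xs len 0<h 0≤Y apart far ∏≤ r²≤ =
  p*p≤q*q⇒p≤q 0≤Y (^-cancel-≤ k (0≤p*p Y)
    (ℚ.≤-trans (subst (λ m → (h * h) ^ m ℚ.≤ ∏ ∥_∥² xs) len (∏-lower-trivial {h} xs far)) ∏≤))
  , p*p≤q*q⇒p≤q (*-nonNeg (ι-nonNeg 17) 0≤Y) (^-cancel-≤ k (0≤p*p (ι 17 * Y)) (begin
      (h * r * (h * r)) ^ suc k             ≤⟨ ^-mono-≤ (suc k) (0≤p*p (h * r)) hr² ⟩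
      (h * h * ι (suc (suc k))) ^ suc k
        ≤⟨ subst (λ m → (h * h * ι (suc m)) ^ m ℚ.≤ ι 48 ^ m * ∏ ∥_∥² xs) len
          (∏-lower-Stirling xs 0<h apart far) ⟩
      ι 48 ^ suc k * ∏ ∥_∥² xs
        ≤⟨ ℚ.*-monoˡ-≤-nonNeg (ι 48 ^ suc k) {{ℚ.nonNegative (^-nonNeg (suc k) (ι-nonNeg 48))}} ∏≤ ⟩
      ι 48 ^ suc k * (Y * Y) ^ suc k        ≡⟨ ^-distrib-* (ι 48) (Y * Y) (suc k) ⟨
      (ι 48 * (Y * Y)) ^ suc k
        ≤⟨ ^-mono-≤ (suc k) (*-nonNeg (ι-nonNeg 48) (0≤p*p Y)) 48≤17² ⟩
      (ι 17 * Y * (ι 17 * Y)) ^ suc k       ∎))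
  where
  open ℚ.≤-Reasoning
  open +-*-Solver
  hr² : h * r * (h * r) ℚ.≤ h * h * ι (suc (suc k))
  hr² = subst (ℚ._≤ h * h * ι (suc (suc k))) (solve 2 (λ h r → h :* h :* (r :* r) :=
    h :* r :* (h :* r)) refl h r)
    (ℚ.*-monoˡ-≤-nonNeg (h * h) {{ℚ.nonNegative (0≤p*p h)}} r²≤)
  48≤17² : ι 48 * (Y * Y) ℚ.≤ ι 17 * Y * (ι 17 * Y)
  -- The slack is `241 = 17² - 48`.
  48≤17² = ≤-by (ι 241 * (Y * Y))
    (solve 1 (λ y → con (ι 48) :* (y :* y) :+ con (ι 241) :* (y :* y) :=
      con (ι 17) :* y :* (con (ι 17) :* y)) refl Y)
    (*-nonNeg (ι-nonNeg 241) (0≤p*p Y))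

-- Passage to the reals

-- By definition the `m`-th term of `∣ z ∣ᶜ` when the point consists of the `m`-th terms of the
-- coordinates of `z`; the maximum with 0 comes from `_^1/_`.
modulus : ℕ → Point → ℚ
modulus m z = rootApprox 2 (∥ z ∥² ℚ.⊔ 0ℚ) m

height : ℕ → Point → ℚ
height m z = 1ℚ ℚ.⊔ modulus m z

1≤height : ∀ m z → 1ℚ ℚ.≤ height m z
1≤height m z = ℚ.p≤p⊔q 1ℚ (modulus m z)

p^2≡p*p : ∀ p → p ^ 2 ≡ p * p
p^2≡p*p p = cong (p *_) (ℚ.*-identityʳ p)

modulus²≤∥∥² : ∀ m z → modulus m z * modulus m z ℚ.≤ ∥ z ∥²
modulus²≤∥∥² m z = subst₂ ℚ._≤_ (p^2≡p*p (modulus m z)) (ℚ.p≥q⇒p⊔q≡p (∥∥²-nonNeg z))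
  (rootApprox-lower 1 (∥ z ∥² ℚ.⊔ 0ℚ) m (ℚ.p≤q⊔p ∥ z ∥² 0ℚ))

∥∥²≤[modulus+unit]² : ∀ m z → ∥ z ∥² ℚ.≤ (modulus m z + unit m) ^ 2
∥∥²≤[modulus+unit]² m z = ℚ.≤-trans (ℚ.p≤p⊔q ∥ z ∥² 0ℚ) (ℚ.<⇒≤ (rootApprox-upper 1
  (∥ z ∥² ℚ.⊔ 0ℚ) m))

-- As heights are at least 1, the additive error `unit m` of the root is absorbed in a factor
-- `1 + unit m`, a form that passes through products.
∥∥²≤height² : ∀ m z → ∥ z ∥² ℚ.≤ height m z * (1ℚ + unit m) * (height m z * (1ℚ + unit m))
∥∥²≤height² m z = begin
  ∥ z ∥²                  ≤⟨ ∥∥²≤[modulus+unit]² m z ⟩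
  (modulus m z + u) ^ 2
    ≤⟨ ^-mono-≤ 2 (+-nonNeg (rootApprox-nonNeg 2 (∥ z ∥² ℚ.⊔ 0ℚ) m) 0≤u) step ⟩
  (b * (1ℚ + u)) ^ 2      ≡⟨ p^2≡p*p (b * (1ℚ + u)) ⟩
  b * (1ℚ + u) * (b * (1ℚ + u)) ∎
  where
  open ℚ.≤-Reasoning
  b u : ℚ
  b = height m z
  u = unit m
  0≤u : 0ℚ ℚ.≤ u
  0≤u = unit-nonNeg m
  step : modulus m z + u ℚ.≤ b * (1ℚ + u)
  step = ℚ.≤-trans (ℚ.+-mono-≤ (ℚ.p≤q⊔p 1ℚ (modulus m z))
      (subst (ℚ._≤ b * u) (ℚ.*-identityˡ u) (ℚ.*-monoʳ-≤-nonNeg u {{ℚ.nonNegative 0≤u}}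
        (1≤height m z))))
    (ℚ.≤-reflexive (solve 2 (λ b u → b :+ b :* u := b :* (con 1ℚ :+ u)) refl b u))
    where open +-*-Solver

∏-height≥0 : ∀ m xs → 0ℚ ℚ.≤ ∏ (height m) xs
∏-height≥0 m []       = ℚ.nonNegative⁻¹ 1ℚ
∏-height≥0 m (x ∷ xs) = *-nonNeg (ℚ.≤-trans (ℚ.nonNegative⁻¹ 1ℚ) (1≤height m x)) (∏-height≥0 m xs)

∏∥∥²≤∏height² : ∀ m xs → let P = ∏ (height m) xs * (1ℚ + unit m) ^ length xs in ∏ ∥_∥² xs ℚ.≤ P * P
∏∥∥²≤∏height² m []       = ℚ.≤-refl
∏∥∥²≤∏height² m (x ∷ xs) = ℚ.≤-trans
  (*-mono-≤ (∥∥²-nonNeg x) (0≤p*p (∏ (height m) xs * (1ℚ + unit m) ^ length xs)) (∥∥²≤height² m x)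
    (∏∥∥²≤∏height² m xs))
  (ℚ.≤-reflexive (solve 4 (λ b c p q → b :* c :* (b :* c) :* (p :* q :* (p :* q)) :=
    b :* p :* (c :* q) :* (b :* p :* (c :* q)))
      refl (height m x) (1ℚ + unit m) (∏ (height m) xs) ((1ℚ + unit m) ^ length xs)))
  where open +-*-Solver

-- `Y` collects two errors: `y + unit m` bounds the root of `M` from above, and `1 + unit m` pays
-- for the rounding of each height.
approximate-bound : ∀ {h y r M} k m xs → length xs ≡ suc k → 0ℚ ℚ.< h → 0ℚ ℚ.≤ y →
  AllPairs (Apart h) xs → All (λ z → h * h ℚ.≤ ∥ z ∥²) xs →
  ∏ (height m) xs ℚ.≤ M → M ℚ.< (y + unit m) ^ suc k → r * r ℚ.≤ ι (suc (suc k)) →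
  let Y = (y + unit m) * (1ℚ + unit m) in h ℚ.≤ Y × h * r ℚ.≤ ι 17 * Y
approximate-bound {h} {y} {r} {M} k m xs len 0<h 0≤y apart far ∏≤M M< r²≤ =
  separation-bound {r = r} k xs len 0<h
    (*-nonNeg (+-nonNeg 0≤y (unit-nonNeg m))
      (ℚ.≤-trans (ℚ.nonNegative⁻¹ 1ℚ) 1≤1+u)) apart far (begin
      ∏ ∥_∥² xs                       ≤⟨ ∏∥∥²≤∏height² m xs ⟩
      P * P                           ≤⟨ *-mono-≤ 0≤P (^-nonNeg (suc k) 0≤Y) P≤ P≤ ⟩
      Y ^ suc k * Y ^ suc k           ≡⟨ ^-distrib-* Y Y (suc k) ⟨
      (Y * Y) ^ suc k                 ∎) r²≤
  where
  open ℚ.≤-Reasoning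
  Y P : ℚ
  Y = (y + unit m) * (1ℚ + unit m)
  P = ∏ (height m) xs * (1ℚ + unit m) ^ length xs
  1≤1+u : 1ℚ ℚ.≤ 1ℚ + unit m
  1≤1+u = ≤-+ʳ (unit-nonNeg m)
  0≤1+u : 0ℚ ℚ.≤ 1ℚ + unit m
  0≤1+u = ℚ.≤-trans (ℚ.nonNegative⁻¹ 1ℚ) 1≤1+u
  0≤Y : 0ℚ ℚ.≤ Y
  0≤Y = *-nonNeg (+-nonNeg 0≤y (unit-nonNeg m)) 0≤1+u
  0≤P : 0ℚ ℚ.≤ P
  0≤P = *-nonNeg (∏-height≥0 m xs) (^-nonNeg (length xs) 0≤1+u)
  P≤ : P ℚ.≤ Y ^ suc k
  P≤ = begin
    P
      ≡⟨ cong (λ l → ∏ (height m) xs * (1ℚ + unit m) ^ l) len ⟩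
    ∏ (height m) xs * (1ℚ + unit m) ^ suc k
      ≤⟨ ℚ.*-monoʳ-≤-nonNeg ((1ℚ + unit m) ^ suc k) {{ℚ.nonNegative (^-nonNeg (suc k) 0≤1+u)}}
        (ℚ.≤-trans ∏≤M (ℚ.<⇒≤ M<)) ⟩
    (y + unit m) ^ suc k * (1ℚ + unit m) ^ suc k
      ≡⟨ ^-distrib-* (y + unit m) (1ℚ + unit m) (suc k) ⟨
    Y ^ suc k                                        ∎

-- From the index in the positivity witness on, the terms are at least `δ` and the cut-off in
-- `cutRecip` is inactive.
recip-inverse : ∀ x (0<x : 0ᴿ <ᴿ x) →
  ∃[ N ] (∀ m → N ≤ m → seq x m * seq (recip x 0<x) m ≡ 1ℚ × 0ℚ ℚ.≤ seq (recip x 0<x) m)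
recip-inverse x (δ , 0<δ , N , δ≤x) = N , λ m N≤m →
  let q = seq x m ℚ.⊔ δ
      0<q = 0<q⊔δ (seq x m) 0<δ
      q≡x = ℚ.p≥q⇒p⊔q≡p (subst (ℚ._≤ seq x m) (ℚ.+-identityˡ δ) (δ≤x m N≤m))
  in subst (λ p → p * cutRecip δ 0<δ (seq x m) ≡ 1ℚ) q≡x (ℚ.*-inverseʳ q {{ℚ.>-nonZero 0<q}})
   , ℚ.<⇒≤ (ℚ.positive⁻¹ (cutRecip δ 0<δ (seq x m)) {{ℚ.1/pos⇒pos q {{ℚ.positive 0<q}}}})

min-constant-bound : ∀ {t r R Y} → 0ℚ ℚ.≤ Y → 0ℚ ℚ.≤ R → r * R ≡ 1ℚ →
  t ℚ.≤ ι 2 * Y → t * r ℚ.≤ ι 34 * Y → t ℚ.≤ (ι 2 ℚ.⊓ (ι 34 * R)) * Y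
min-constant-bound {t} {r} {R} {Y} 0≤Y 0≤R rR≡1 t≤2Y tr≤34Y =
  subst (t ℚ.≤_) (sym (ℚ.*-distribʳ-⊓-nonNeg Y {{ℚ.nonNegative 0≤Y}} (ι 2) (ι 34 * R)))
    (ℚ.⊓-glb t≤2Y (begin
      t                ≡⟨ ℚ.*-identityʳ t ⟨
      t * 1ℚ           ≡⟨ cong (t *_) rR≡1 ⟨
      t * (r * R)      ≡⟨ ℚ.*-assoc t r R ⟨
      t * r * R        ≤⟨ ℚ.*-monoʳ-≤-nonNeg R {{ℚ.nonNegative 0≤R}} tr≤34Y ⟩
      ι 34 * Y * R     ≡⟨ solve 3 (λ a y r → a :* y :* r := a :* r :* y) refl (ι 34) Y R ⟩
      ι 34 * R * Y     ∎))
  where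
  open ℚ.≤-Reasoning
  open +-*-Solver

-- The error is `C (y + 1 + u) u`, in which `C ≤ 2`, `y ≤ B` and `u ≤ 1`.
rounding-error : ∀ {C y u B} → C ℚ.≤ ι 2 → 0ℚ ℚ.≤ u → u ℚ.≤ 1ℚ → 0ℚ ℚ.≤ y → y ℚ.≤ B →
  C * ((y + u) * (1ℚ + u)) ℚ.≤ C * y + ι 2 * (B + ι 2) * u
rounding-error {C} {y} {u} {B} C≤2 0≤u u≤1 0≤y y≤B = begin
  C * ((y + u) * (1ℚ + u))
    ≡⟨ solve 3 (λ c y u → c :* ((y :+ u) :* (con 1ℚ :+ u)) :=
      c :* y :+ c :* ((y :+ (con 1ℚ :+ u)) :* u)) refl C y u ⟩
  C * y + C * (v * u)   ≤⟨ ℚ.+-monoʳ-≤ (C * y) (ℚ.≤-trans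
    (ℚ.*-monoʳ-≤-nonNeg (v * u) {{ℚ.nonNegative (*-nonNeg 0≤v 0≤u)}} C≤2)
    (ℚ.*-monoˡ-≤-nonNeg (ι 2) {{ℚ.nonNegative (ι-nonNeg 2)}}
      (ℚ.*-monoʳ-≤-nonNeg u {{ℚ.nonNegative 0≤u}} (ℚ.+-mono-≤ y≤B (ℚ.+-monoʳ-≤ 1ℚ u≤1))))) ⟩
  C * y + ι 2 * ((B + ι 2) * u)      ≡⟨ cong (C * y +_) (sym (ℚ.*-assoc (ι 2) (B + ι 2) u)) ⟩
  C * y + ι 2 * (B + ι 2) * u        ∎
  where
  open ℚ.≤-Reasoning
  open +-*-Solver
  v : ℚ
  v = y + (1ℚ + u)
  0≤v : 0ℚ ℚ.≤ v
  0≤v = +-nonNeg 0≤y (+-nonNeg (ℚ.nonNegative⁻¹ 1ℚ) 0≤u)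

-- The common interface of the two cases, at a fixed stage `m`: `k + 1` points with half-separation
-- `h`. In the first case one root has been dropped and `n = k + 2`; in the second all are kept and
-- `n = k + 1`.
Configuration : ℚ → ℕ → ℕ → ℚ → Set
Configuration h k m M = ∃[ xs ] (length xs ≡ suc k × AllPairs (Apart h) xs ×
  All (λ z → h * h ℚ.≤ ∥ z ∥²) xs × ∏ (height m) xs ℚ.≤ M)

configuration-bound : ∀ {C r R y B M h η} n k m → n ≤ suc (suc k) →
  C ≡ ι 2 ℚ.⊓ (ι 34 * R) → r * R ≡ 1ℚ → 0ℚ ℚ.≤ R → r * r ℚ.≤ ι n →
  0ℚ ℚ.≤ y → y ℚ.≤ B → M ℚ.< (y + unit m) ^ suc k → unit m ℚ.≤ 1ℚ → ι 2 * (B + ι 2) * unit m ℚ.≤ η →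
  0ℚ ℚ.< h → Configuration h k m M → h + h ℚ.≤ C * y + η
configuration-bound {C} {r} {R} {y} {B} {M} {h} {η} n k m
  n≤2+k refl rR≡1 0≤R r²≤n 0≤y y≤B M< u≤1 error≤η 0<h
  (xs , len , apart , far , ∏≤M) = begin
    h + h
      ≤⟨ min-constant-bound {h + h} {r} {R} {Y} 0≤Y 0≤R rR≡1 2h≤2Y 2hr≤34Y ⟩
    C * Y
      ≤⟨ rounding-error {C} {y} {unit m} {B} (ℚ.p⊓q≤p (ι 2) (ι 34 * R))
        (unit-nonNeg m) u≤1 0≤y y≤B ⟩
    C * y + ι 2 * (B + ι 2) * unit m   ≤⟨ ℚ.+-monoʳ-≤ (C * y) error≤η ⟩
    C * y + η                          ∎
  where
  open ℚ.≤-Reasoning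
  open +-*-Solver
  Y : ℚ
  Y = (y + unit m) * (1ℚ + unit m)
  0≤Y : 0ℚ ℚ.≤ Y
  0≤Y = *-nonNeg (+-nonNeg 0≤y (unit-nonNeg m)) (+-nonNeg (ℚ.nonNegative⁻¹ 1ℚ) (unit-nonNeg m))
  bounds : h ℚ.≤ Y × h * r ℚ.≤ ι 17 * Y
  bounds = approximate-bound {h} {y} {r} {M} k m xs len 0<h 0≤y apart far ∏≤M M<
    (ℚ.≤-trans r²≤n (ι-mono-≤ n≤2+k))
  2h≤2Y : h + h ℚ.≤ ι 2 * Y
  2h≤2Y = ℚ.≤-trans (ℚ.+-mono-≤ (proj₁ bounds) (proj₁ bounds))
    (ℚ.≤-reflexive (solve 1 (λ y → y :+ y := con (ι 2) :* y) refl Y))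
  2hr≤34Y : (h + h) * r ℚ.≤ ι 34 * Y
  2hr≤34Y = ℚ.≤-trans (ℚ.≤-reflexive (solve 2 (λ h r → (h :+ h) :* r := h :* r :+ h :* r) refl h r))
    (ℚ.≤-trans (ℚ.+-mono-≤ (proj₂ bounds) (proj₂ bounds))
      (ℚ.≤-reflexive (solve 1 (λ y → con (ι 17) :* y :+ con (ι 17) :* y := con (ι 34) :* y)
        refl Y)))

-- Reduces a bound on `s` to positive `h`: if `s ≤ e` the claim is immediate, and otherwise
-- `h = (s - e) / 2` is admissible.
small-or-double : ∀ {s e b} → 0ℚ ℚ.≤ b →
  (∀ h → 0ℚ ℚ.< h → h + h + e ℚ.≤ s → h + h ℚ.≤ b) → s ℚ.≤ b + e
small-or-double {s} {e} {b} 0≤b double with 0ℚ ℚ.<? s - e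
... | no  s≤e = subst₂ ℚ._≤_ (a-b+b s e) refl (ℚ.+-monoˡ-≤ e (ℚ.≤-trans (ℚ.≮⇒≥ s≤e) 0≤b))
... | yes e<s = subst₂ ℚ._≤_ (trans (cong (_+ e) (half+half (s - e))) (a-b+b s e)) refl
  (ℚ.+-monoˡ-≤ e (double (½ * (s - e)) (half-pos e<s)
    (ℚ.≤-reflexive (trans (cong (_+ e) (half+half (s - e))) (a-b+b s e)))))

-- Of the tolerance `ε`, one half is the slack granted to the configurations and the other half
-- covers the rounding error `D * unit m`.
separation-≤ : ∀ n (2≤n : 2 ≤ n) k (S M : ℝ) → n ≤ suc (suc k) →
  (∀ ε → 0ℚ ℚ.< ε → ∃[ N ] (∀ m → N ≤ m → ∀ h → 0ℚ ℚ.< h → h + h + ε ℚ.≤ seq S m →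
    Configuration h k m (seq M m))) →
  S ≤ᴿ constant n 2≤n *ᴿ (M ^1/ suc k)
separation-≤ n 2≤n k S M n≤2+k configuration ε 0<ε =
  let √n = √ fromℕ n
      0<√n = √-pos {fromℕ n} (fromℕ-pos (ℕ.<-trans ℕ.z<s 2≤n))
      B , 0<B , N₁ , y≤B = eventuallyBounded {seq (M ^1/ suc k)} (cauchy (M ^1/ suc k))
      N₂ , inverse = recip-inverse √n 0<√n
      N₃ , conf = configuration (½ * ε) (half-pos 0<ε)
      N₄ , u<1 = unit-small 1ℚ (ℚ.positive⁻¹ 1ℚ)
      D = ι 2 * (B + ι 2)
      0<D = *-pos (ℚ.positive⁻¹ (ι 2)) (ℚ.<-trans 0<B (<-by (ι 2) refl (ℚ.positive⁻¹ (ι 2))))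
      η , 0<η , Dη≡ε/2 = divide-tolerance D (½ * ε) 0<D (half-pos 0<ε)
      N₅ , u<η = unit-small η 0<η
      N₁₂ = N₁ ℕ.⊔ N₂
      N₁₂₃ = N₁₂ ℕ.⊔ N₃
      N₄₅ = N₄ ℕ.⊔ N₅
  in N₁₂₃ ℕ.⊔ N₄₅ , λ m N≤m →
    let N₁₂₃≤m = ℕ.m⊔n≤o⇒m≤o N₁₂₃ N₄₅ N≤m
        N₁₂≤m = ℕ.m⊔n≤o⇒m≤o N₁₂ N₃ N₁₂₃≤m
        N₄₅≤m = ℕ.m⊔n≤o⇒n≤o N₁₂₃ N₄₅ N≤m
        y = seq (M ^1/ suc k) m
        0≤y = rootApprox-nonNeg (suc k) (seq M m ℚ.⊔ 0ℚ) m
        r = seq √n m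
        R = seq (recip √n 0<√n) m
        rR≡1 , 0≤R = inverse m (ℕ.m⊔n≤o⇒n≤o N₁ N₂ N₁₂≤m)
        C = ι 2 ℚ.⊓ (ι 34 * R)
        0≤C = ℚ.⊓-glb (ι-nonNeg 2) (*-nonNeg (ι-nonNeg 34) 0≤R)
        b = C * y + ½ * ε
    in ℚ.≤-trans
         (small-or-double {seq S m} {½ * ε} {b} (+-nonNeg (*-nonNeg 0≤C 0≤y) (ℚ.<⇒≤
           (half-pos 0<ε))) λ h 0<h 2h≤ →
           configuration-bound {C} {r} {R} {y} {B} {seq M m} {h} {½ * ε} n k m n≤2+k refl rR≡1 0≤R
             (root² m) 0≤y
             (ℚ.≤-trans (p≤∣p∣ y) (y≤B m (ℕ.m⊔n≤o⇒m≤o N₁ N₂ N₁₂≤m)))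
             (ℚ.≤-<-trans (ℚ.p≤p⊔q (seq M m) 0ℚ) (rootApprox-upper k (seq M m ℚ.⊔ 0ℚ) m))
             (ℚ.<⇒≤ (u<1 m (ℕ.m⊔n≤o⇒m≤o N₄ N₅ N₄₅≤m)))
             (subst (D * unit m ℚ.≤_) Dη≡ε/2 (ℚ.*-monoˡ-≤-nonNeg D {{ℚ.nonNegative (ℚ.<⇒≤ 0<D)}}
               (ℚ.<⇒≤ (u<η m (ℕ.m⊔n≤o⇒n≤o N₄ N₅ N₄₅≤m)))))
             0<h (conf m (ℕ.m⊔n≤o⇒n≤o N₁₂ N₃ N₁₂₃≤m) h 0<h 2h≤))
         (ℚ.≤-reflexive (trans (ℚ.+-assoc (C * y) (½ * ε) (½ * ε)) (cong (C * y +_) (half+half ε))))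
  where
  root² : ∀ m → seq (√ fromℕ n) m * seq (√ fromℕ n) m ℚ.≤ ι n
  root² m = subst₂ ℚ._≤_ (p^2≡p*p (seq (√ fromℕ n) m)) (ℚ.p≥q⇒p⊔q≡p (ι-nonNeg n))
    (rootApprox-lower 1 (ι n ℚ.⊔ 0ℚ) m (ℚ.p≤q⊔p (ι n) 0ℚ))

-- Configurations of roots

at : ℕ → ℂ → Point
at m z = seq (re z) m , seq (im z) m

points : ∀ {n} → Vector ℂ n → ℕ → List Point
points α m = tabulate (λ i → at m (α i))

mahler-seq : ∀ {n} (α : Vector ℂ n) m →
  seq (Vector.foldr _*ᴿ_ 1ᴿ (λ i → 1ᴿ ⊔ᴿ ∣ α i ∣ᶜ)) m ≡ ∏ (height m) (points α m)
mahler-seq {zero}  α m = refl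
mahler-seq {suc n} α m = cong (height m (at m (α Fin.zero)) *_) (mahler-seq (λ i → α (Fin.suc i)) m)

minimum-≤ : ∀ {x xs} → x ∈ xs → ∀ m → seq (minimum xs) m ℚ.≤ seq x m
minimum-≤ {xs = _ ∷ []}     (here refl)  m = ℚ.≤-refl
minimum-≤ {xs = x ∷ y ∷ xs} (here refl)  m = ℚ.p⊓q≤p (seq x m) (seq (minimum (y ∷ xs)) m)
minimum-≤ {xs = x ∷ y ∷ xs} (there z∈xs) m =
  ℚ.≤-trans (ℚ.p⊓q≤q (seq x m) (seq (minimum (y ∷ xs)) m)) (minimum-≤ z∈xs m)

sep-≤ : ∀ {n f} (s : Separable n f) {i j} → i ≢ j → ∀ m →
  seq (sep s) m ℚ.≤ seq ∣ root s i -ᶜ root s j ∣ᶜ m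
sep-≤ {n} s {i} {j} i≢j = minimum-≤
  (∈-map⁺ (λ (i , j) → ∣ root s i -ᶜ root s j ∣ᶜ)
    (∈-filter⁺ (λ (i , j) → ¬? (i Fin.≟ j)) (∈-cartesianProduct⁺ (∈-allFin i) (∈-allFin j)) i≢j))

[h+h]²≡4h² : ∀ h → (h + h) * (h + h) ≡ ι 4 * (h * h)
[h+h]²≡4h² = solve 1 (λ h → (h :+ h) :* (h :+ h) := con (ι 4) :* (h :* h)) refl
  where open +-*-Solver

0<p⇒0<p+p : ∀ {p} → 0ℚ ℚ.< p → 0ℚ ℚ.< p + p
0<p⇒0<p+p 0<p = ℚ.<-trans 0<p (<-by _ refl 0<p)

-- The approximate modulus never exceeds the exact one, so a lower bound on it passes to the squared
-- distance without loss.
points-Apart : ∀ {n f} (s : Separable n f) m {h} → 0ℚ ℚ.< h → h + h ℚ.≤ seq (sep s) m →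
  AllPairs (Apart h) (points (root s) m)
points-Apart s m {h} 0<h 2h≤sep = AllPairs.tabulate⁺ λ {i} {j} i≢j →
  apart (at m (root s i -ᶜ root s j)) (ℚ.≤-trans 2h≤sep (sep-≤ s i≢j m))
  where
  apart : ∀ w → h + h ℚ.≤ modulus m w → ι 4 * (h * h) ℚ.≤ ∥ w ∥²
  apart w 2h≤w = subst (ℚ._≤ ∥ w ∥²) ([h+h]²≡4h² h) (ℚ.≤-trans
    (*-mono-≤ (ℚ.<⇒≤ (0<p⇒0<p+p 0<h)) (rootApprox-nonNeg 2 (∥ w ∥² ℚ.⊔ 0ℚ) m) 2h≤w 2h≤w)
    (modulus²≤∥∥² m w))

-- The parallelogram law: the difference of the two sides is the squared norm of `z + w`.
distSq≤ : ∀ z w → distSq z w ℚ.≤ ι 2 * ∥ z ∥² + ι 2 * ∥ w ∥²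
distSq≤ (a , b) (c , d) = ≤-by ((a + c) * (a + c) + (b + d) * (b + d))
  (solve 4 (λ a b c d → (a :- c) :* (a :- c) :+ (b :- d) :* (b :- d) :+ ((a :+ c) :* (a :+ c) :+
    (b :+ d) :* (b :+ d)) :=
    con (ι 2) :* (a :* a :+ b :* b) :+ con (ι 2) :* (c :* c :+ d :* d)) refl a b c d)
  (+-nonNeg (0≤p*p (a + c)) (0≤p*p (b + d)))
  where open +-*-Solver

larger-is-far : ∀ {h} z w → Apart h z w → ∥ z ∥² ℚ.≤ ∥ w ∥² → h * h ℚ.≤ ∥ w ∥²
larger-is-far {h} z w apart z≤w = ℚ.*-cancelˡ-≤-pos (ι 4) (begin
  ι 4 * (h * h)                       ≤⟨ apart ⟩
  distSq z w                          ≤⟨ distSq≤ z w ⟩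
  ι 2 * ∥ z ∥² + ι 2 * ∥ w ∥²         ≤⟨ ℚ.+-monoˡ-≤ (ι 2 * ∥ w ∥²) (ℚ.*-monoˡ-≤-nonNeg (ι 2) z≤w) ⟩
  ι 2 * ∥ w ∥² + ι 2 * ∥ w ∥²         ≡⟨ ℚ.*-distribʳ-+ ∥ w ∥² (ι 2) (ι 2) ⟨
  ι 4 * ∥ w ∥²                        ∎)
  where open ℚ.≤-Reasoning

-- Every other point is far from 0 because it is at least as large as the dropped one and apart from
-- it. The dropped height is at least 1, so the product does not grow.
drop-smallest : ∀ {h k m} z zs → length zs ≡ suc k → AllPairs (Apart h) (z ∷ zs) →
  Configuration h k m (∏ (height m) (z ∷ zs))
drop-smallest {h} {k} {m} z zs len apart with extract-extremum (λ v w → ∥ v ∥² ℚ.≤ ∥ w ∥²)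
  (λ v w → ℚ.≤-total ∥ v ∥² ∥ w ∥²) ℚ.≤-trans z zs
... | a , xs , perm , a-min with AllPairs-resp-↭ (λ {v} {w} → Apart-sym {h} {v} {w}) perm apart
...   | a-apart ∷ xs-apart =
  xs , trans (ℕ.suc-injective (sym (↭-length perm))) len , xs-apart
     , All.zipWith (λ {w} (aw , a≤w) → larger-is-far {h} a w aw a≤w) (a-apart , a-min)
     , subst (∏ (height m) xs ℚ.≤_) (sym (∏-↭ (height m) perm))
         (subst (ℚ._≤ height m a * ∏ (height m) xs) (ℚ.*-identityˡ (∏ (height m) xs))
           (ℚ.*-monoʳ-≤-nonNeg (∏ (height m) xs) {{ℚ.nonNegative (∏-height≥0 m xs)}}
             (1≤height m a)))

general-configuration : ∀ {k f} (s : Separable (suc (suc k)) f) ε → 0ℚ ℚ.< ε →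
  ∃[ N ] (∀ m → N ≤ m → ∀ h → 0ℚ ℚ.< h → h + h + ε ℚ.≤ seq (sep s) m →
    Configuration h k m (seq (mahlerMeasure s) m))
general-configuration {k} s ε 0<ε = 0 , λ m _ h 0<h 2h+ε≤sep →
  subst (Configuration h k m) (sym (mahler-seq (root s) m))
    (drop-smallest {h} {k} {m} (at m (root s Fin.zero))
      (points (λ i → root s (Fin.suc i)) m) (List.length-tabulate (λ i → at m (root s (Fin.suc i))))
      (points-Apart s m {h} 0<h (ℚ.≤-trans (≤-+ʳ (ℚ.<⇒≤ 0<ε)) 2h+ε≤sep)))

eventually-all : ∀ {n} (P : Fin n → ℕ → Set) → (∀ i → ∃[ N ] (∀ m → N ≤ m → P i m)) →
  ∃[ N ] (∀ m → N ≤ m → ∀ i → P i m)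
eventually-all {zero}  P ev = 0 , λ _ _ ()
eventually-all {suc n} P ev =
  let N₁ , p₁ = ev Fin.zero
      N₂ , p₂ = eventually-all (λ i → P (Fin.suc i)) (λ i → ev (Fin.suc i))
  in N₁ ℕ.⊔ N₂ , λ m N≤m → λ where
       Fin.zero    → p₁ m (ℕ.m⊔n≤o⇒m≤o N₁ N₂ N≤m)
       (Fin.suc i) → p₂ m (ℕ.m⊔n≤o⇒n≤o N₁ N₂ N≤m) i

-- All roots are kept. The `ε` lost in comparing `sep s` with twice the modulus cancels the `ε` of
-- slack, which leaves `h` at most the approximate modulus.
far-configuration : ∀ {k f} (s : Separable (suc k) f) →
  (∀ i → sep s ≤ᴿ fromℕ 2 *ᴿ ∣ root s i ∣ᶜ) → ∀ ε → 0ℚ ℚ.< ε →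
  ∃[ N ] (∀ m → N ≤ m → ∀ h → 0ℚ ℚ.< h → h + h + ε ℚ.≤ seq (sep s) m →
    Configuration h k m (seq (mahlerMeasure s) m))
far-configuration {k} s sep≤ ε 0<ε =
  let N , sep≤′ = eventually-all (λ i m → seq (sep s) m ℚ.≤ ι 2 * modulus m (at m (root s i)) + ε)
                    (λ i → sep≤ i ε 0<ε)
  in N , λ m N≤m h 0<h 2h+ε≤sep →
    points (root s) m , List.length-tabulate (λ i → at m (root s i))
    , points-Apart s m {h} 0<h (ℚ.≤-trans (≤-+ʳ (ℚ.<⇒≤ 0<ε)) 2h+ε≤sep)
    , All.tabulate⁺ {f = λ i → at m (root s i)} (λ i → far m (at m (root s i)) {h} 0<h
      (ℚ.≤-trans 2h+ε≤sep (sep≤′ m N≤m i)))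
    , ℚ.≤-reflexive (sym (mahler-seq (root s) m))
  where
  far : ∀ m w {h} → 0ℚ ℚ.< h → h + h + ε ℚ.≤ ι 2 * modulus m w + ε → h * h ℚ.≤ ∥ w ∥²
  far m w {h} 0<h 2h+ε≤ = ℚ.≤-trans
    (*-mono-≤ (ℚ.<⇒≤ 0<h) (rootApprox-nonNeg 2 (∥ w ∥² ℚ.⊔ 0ℚ) m) h≤w h≤w) (modulus²≤∥∥² m w)
    where
    open +-*-Solver
    h≤w : h ℚ.≤ modulus m w
    h≤w = ℚ.*-cancelˡ-≤-pos (ι 2) (subst₂ ℚ._≤_
      (solve 2 (λ h e → h :+ h :+ e :- e := con (ι 2) :* h) refl h ε)
      (solve 2 (λ w e → con (ι 2) :* w :+ e :- e := con (ι 2) :* w) refl (modulus m w) ε)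
      (ℚ.+-monoˡ-≤ (- ε) 2h+ε≤))

-- Order and null sequences

-- A single comparison of rational terms at a late index decides, with `δ = ε / 5`: later terms move
-- by less than `δ` each, so the threshold `3δ` leaves at most `5δ = ε` on one side and a margin of
-- `δ` on the other.
<-or-≤ : ∀ x y ε → 0ℚ ℚ.< ε →
  (y <ᴿ x) ⊎ ∃[ N ] (∀ n → N ≤ n → seq x n ℚ.≤ seq y n + ε)
<-or-≤ x y ε 0<ε = dichotomy (divide-tolerance (ι 5) ε (ℚ.positive⁻¹ (ι 5)) 0<ε)
  where
  open +-*-Solver
  dichotomy : ∃[ δ ] (0ℚ ℚ.< δ × ι 5 * δ ≡ ε) →
    (y <ᴿ x) ⊎ ∃[ N ] (∀ n → N ≤ n → seq x n ℚ.≤ seq y n + ε)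
  dichotomy (δ , 0<δ , 5δ≡ε) with toOneSided {seq x} (cauchy x) δ 0<δ |
    toOneSided {seq y} (cauchy y) δ 0<δ
  ... | N₁ , px | N₂ , py with seq x (N₁ ℕ.⊔ N₂) ℚ.≤? seq y (N₁ ℕ.⊔ N₂) + ι 3 * δ
  ...   | yes x≤y = inj₂ (N , λ n N≤n → ℚ.<⇒≤ (begin-strict
    seq x n                             <⟨ px n N (ℕ.m⊔n≤o⇒m≤o N₁ N₂ N≤n) (ℕ.m≤m⊔n N₁ N₂) ⟩
    seq x N + δ                         ≤⟨ ℚ.+-monoˡ-≤ δ x≤y ⟩
    seq y N + ι 3 * δ + δ
      <⟨ ℚ.+-monoˡ-< δ (ℚ.+-monoˡ-< (ι 3 * δ) (py N n (ℕ.m≤n⊔m N₁ N₂) (ℕ.m⊔n≤o⇒n≤o N₁ N₂ N≤n))) ⟩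
    seq y n + δ + ι 3 * δ + δ
      ≡⟨ solve 2 (λ y d → y :+ d :+ con (ι 3) :* d :+ d := y :+ con (ι 5) :* d) refl (seq y n) δ ⟩
    seq y n + ι 5 * δ                   ≡⟨ cong (seq y n +_) 5δ≡ε ⟩
    seq y n + ε                         ∎))
    where
    open ℚ.≤-Reasoning
    N : ℕ
    N = N₁ ℕ.⊔ N₂
  ...   | no x≰y = inj₁ (δ , 0<δ , N , λ n N≤n → ℚ.<⇒≤ (+-cancelʳ-< (ι 2 * δ) (begin-strict
    seq y n + δ + ι 2 * δ
      ≡⟨ solve 2 (λ y d → y :+ d :+ con (ι 2) :* d := y :+ con (ι 3) :* d) refl (seq y n) δ ⟩
    seq y n + ι 3 * δ
      <⟨ ℚ.+-monoˡ-< (ι 3 * δ) (py n N (ℕ.m⊔n≤o⇒n≤o N₁ N₂ N≤n) (ℕ.m≤n⊔m N₁ N₂)) ⟩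
    seq y N + δ + ι 3 * δ
      ≡⟨ solve 3 (λ y d t → y :+ d :+ t := y :+ t :+ d) refl (seq y N) δ (ι 3 * δ) ⟩
    seq y N + ι 3 * δ + δ               <⟨ ℚ.+-monoˡ-< δ (ℚ.≰⇒> x≰y) ⟩
    seq x N + δ
      <⟨ ℚ.+-monoˡ-< δ (px N n (ℕ.m≤m⊔n N₁ N₂) (ℕ.m⊔n≤o⇒m≤o N₁ N₂ N≤n)) ⟩
    seq x n + δ + δ
      ≡⟨ solve 2 (λ x d → x :+ d :+ d := x :+ con (ι 2) :* d) refl (seq x n) δ ⟩
    seq x n + ι 2 * δ                   ∎)))
    where
    open ℚ.≤-Reasoning
    N : ℕ
    N = N₁ ℕ.⊔ N₂
    +-cancelʳ-< : ∀ {a b} c → a + c ℚ.< b + c → a ℚ.< b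
    +-cancelʳ-< {a} {b} c h = subst₂ ℚ._<_ (solve 2 (λ a c → a :+ c :- c := a) refl a c)
      (solve 2 (λ a c → a :+ c :- c := a) refl b c) (ℚ.+-monoˡ-< (- c) h)

<⇒≱ : ∀ {x y} → y <ᴿ x → ¬ (x ≤ᴿ y)
<⇒≱ {x} {y} (δ , 0<δ , N₁ , y+δ≤x) x≤y with x≤y (½ * δ) (half-pos 0<δ)
... | N₂ , x≤y+δ/2 = ℚ.<-irrefl refl (begin-strict
    seq y n + δ            ≤⟨ y+δ≤x n (ℕ.m≤m⊔n N₁ N₂) ⟩
    seq x n                ≤⟨ x≤y+δ/2 n (ℕ.m≤n⊔m N₁ N₂) ⟩
    seq y n + ½ * δ
      <⟨ ℚ.+-monoʳ-< (seq y n) (subst (½ * δ ℚ.<_) (half+half δ) (<-by (½ * δ)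
        refl (half-pos 0<δ))) ⟩
    seq y n + δ            ∎)
  where
  open ℚ.≤-Reasoning
  n : ℕ
  n = N₁ ℕ.⊔ N₂

<⇒≤ᴿ : ∀ {x y} → x <ᴿ y → x ≤ᴿ y
<⇒≤ᴿ (δ , 0<δ , N , x+δ≤y) ε 0<ε = N , λ n N≤n →
  ℚ.≤-trans (≤-+ʳ (ℚ.<⇒≤ 0<δ)) (ℚ.≤-trans (x+δ≤y n N≤n) (≤-+ʳ (ℚ.<⇒≤ 0<ε)))

≮⇒≥ᴿ : ∀ {x y} → ¬ (y <ᴿ x) → x ≤ᴿ y
≮⇒≥ᴿ {x} {y} y≮x ε 0<ε with <-or-≤ x y ε 0<ε
... | inj₁ y<x = contradiction y<x y≮x
... | inj₂ x≤y = x≤y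

≤ᴿ-stable : ∀ {x y} → ¬ ¬ (x ≤ᴿ y) → x ≤ᴿ y
≤ᴿ-stable {x} {y} ¬¬x≤y = ≮⇒≥ᴿ {x} {y} λ y<x → ¬¬x≤y (<⇒≱ {x} {y} y<x)

≰⇒≥ᴿ : ∀ {x y} → ¬ (x ≤ᴿ y) → y ≤ᴿ x
≰⇒≥ᴿ {x} {y} x≰y = ≮⇒≥ᴿ {y} {x} λ x<y → x≰y (<⇒≤ᴿ {x} {y} x<y)

≤ᴿ-refl : ∀ x → x ≤ᴿ x
≤ᴿ-refl x ε 0<ε = 0 , λ n _ → ≤-+ʳ (ℚ.<⇒≤ 0<ε)

≤ᴿ-trans : ∀ {x y z} → x ≤ᴿ y → y ≤ᴿ z → x ≤ᴿ z
≤ᴿ-trans {x} {y} {z} x≤y y≤z ε 0<ε with x≤y (½ * ε) (half-pos 0<ε) | y≤z (½ * ε) (half-pos 0<ε)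
... | N₁ , p | N₂ , q = N₁ ℕ.⊔ N₂ , λ n N≤n → begin
    seq x n                          ≤⟨ p n (ℕ.m⊔n≤o⇒m≤o N₁ N₂ N≤n) ⟩
    seq y n + ½ * ε                  ≤⟨ ℚ.+-monoˡ-≤ (½ * ε) (q n (ℕ.m⊔n≤o⇒n≤o N₁ N₂ N≤n)) ⟩
    seq z n + ½ * ε + ½ * ε          ≡⟨ ℚ.+-assoc (seq z n) (½ * ε) (½ * ε) ⟩
    seq z n + (½ * ε + ½ * ε)        ≡⟨ cong (seq z n +_) (half+half ε) ⟩
    seq z n + ε                      ∎
  where open ℚ.≤-Reasoning

double-mono-≤ᴿ : ∀ {x y} → x ≤ᴿ y → fromℕ 2 *ᴿ x ≤ᴿ fromℕ 2 *ᴿ y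
double-mono-≤ᴿ {x} {y} x≤y ε 0<ε with x≤y (½ * ε) (half-pos 0<ε)
... | N , p = N , λ n N≤n → ℚ.≤-trans (ℚ.*-monoˡ-≤-nonNeg (ι 2) (p n N≤n))
  (ℚ.≤-reflexive (trans (ℚ.*-distribˡ-+ (ι 2) (seq y n) (½ * ε))
    (cong (ι 2 * seq y n +_) (trans (sym (ℚ.*-assoc (ι 2) ½ ε)) (ℚ.*-identityˡ ε)))))

-- Comparison of reals is not decidable, so the index is found only classically; this suffices for
-- proving inequalities `≤ᴿ`, which are stable.
¬¬-minimal : ∀ {n} (g : Fin (suc n) → ℝ) → ¬ ¬ (∃[ i ] (∀ j → g i ≤ᴿ g j))
¬¬-minimal {zero}  g none = none (Fin.zero , λ { Fin.zero → ≤ᴿ-refl (g Fin.zero) })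
¬¬-minimal {suc n} g none = ¬¬-minimal (λ i → g (Fin.suc i)) λ (i , i-min) →
  let below : ¬ (g Fin.zero ≤ᴿ g (Fin.suc i))
      below le = none (Fin.zero , λ where
        Fin.zero    → ≤ᴿ-refl (g Fin.zero)
        (Fin.suc j) → ≤ᴿ-trans {g Fin.zero} {g (Fin.suc i)} {g (Fin.suc j)} le (i-min j))
  in none (Fin.suc i , λ where
       Fin.zero    → ≰⇒≥ᴿ {g Fin.zero} {g (Fin.suc i)} below
       (Fin.suc j) → i-min j)

Null : (ℕ → ℚ) → Set
Null x = ∀ ε → 0ℚ ℚ.< ε → ∃[ N ] (∀ n → N ≤ n → ℚ.∣ x n ∣ ℚ.< ε)

Null-resp : ∀ {x y} → (∀ n → x n ≡ y n) → Null x → Null y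
Null-resp x≡y x-null ε 0<ε with x-null ε 0<ε
... | N , p = N , λ n N≤n → subst (λ q → ℚ.∣ q ∣ ℚ.< ε) (x≡y n) (p n N≤n)

Null-+ : ∀ {x y} → Null x → Null y → Null (λ n → x n + y n)
Null-+ {x} {y} x-null y-null ε 0<ε with x-null (½ * ε) (half-pos 0<ε)
  | y-null (½ * ε) (half-pos 0<ε)
... | N₁ , p | N₂ , q = N₁ ℕ.⊔ N₂ , λ n N≤n → ℚ.≤-<-trans (ℚ.∣p+q∣≤∣p∣+∣q∣ (x n) (y n))
  (subst (ℚ.∣ x n ∣ + ℚ.∣ y n ∣ ℚ.<_) (half+half ε)
    (ℚ.+-mono-< (p n (ℕ.m⊔n≤o⇒m≤o N₁ N₂ N≤n)) (q n (ℕ.m⊔n≤o⇒n≤o N₁ N₂ N≤n))))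

Null-*ˡ : ∀ (x : ℝ) {y} → Null y → Null (λ n → seq x n * y n)
Null-*ˡ x {y} y-null ε 0<ε =
  let B , 0<B , N₁ , x≤B = eventuallyBounded {seq x} (cauchy x)
      η , 0<η , Bη≡ε = divide-tolerance B ε 0<B 0<ε
      N₂ , y<η = y-null η 0<η
  in N₁ ℕ.⊔ N₂ , λ n N≤n → subst₂ ℚ._<_ (sym (ℚ.∣p*q∣≡∣p∣*∣q∣ (seq x n) (y n))) Bη≡ε
       (ℚ.≤-<-trans
         (ℚ.*-monoʳ-≤-nonNeg ℚ.∣ y n ∣ {{ℚ.nonNegative (ℚ.0≤∣p∣ (y n))}} (x≤B n
           (ℕ.m⊔n≤o⇒m≤o N₁ N₂ N≤n)))
         (ℚ.*-monoʳ-<-pos B {{ℚ.positive 0<B}} (y<η n (ℕ.m⊔n≤o⇒n≤o N₁ N₂ N≤n))))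

Null-neg : ∀ {x} → Null x → Null (λ n → - x n)
Null-neg {x} x-null ε 0<ε with x-null ε 0<ε
... | N , p = N , λ n N≤n → subst (ℚ._< ε) (sym (ℚ.∣-p∣≡∣p∣ (x n))) (p n N≤n)

-- `z ≃ᶜ w` unfolds to `IsNull (z -ᶜ w)`, and the two are interchanged freely below.
IsNull : ℂ → Set
IsNull z = Null (seq (re z)) × Null (seq (im z))

infix 4 _≐_

_≐_ : ℂ → ℂ → Set
z ≐ w = ∀ n → seq (re z) n ≡ seq (re w) n × seq (im z) n ≡ seq (im w) n

IsNull-resp : ∀ {z w} → z ≐ w → IsNull z → IsNull w
IsNull-resp {z} {w} z≐w (r , i) =
  Null-resp {seq (re z)} {seq (re w)} (λ n → proj₁ (z≐w n)) r ,
  Null-resp {seq (im z)} {seq (im w)} (λ n → proj₂ (z≐w n)) i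

IsNull-+ : ∀ z w → IsNull z → IsNull w → IsNull (z +ᶜ w)
IsNull-+ z w (r , i) (r′ , i′) =
  Null-+ {seq (re z)} {seq (re w)} r r′ , Null-+ {seq (im z)} {seq (im w)} i i′

IsNull-neg : ∀ z → IsNull z → IsNull ((-ᴿ re z) +i (-ᴿ im z))
IsNull-neg z (r , i) = Null-neg {seq (re z)} r , Null-neg {seq (im z)} i

IsNull-- : ∀ z w → IsNull z → IsNull w → IsNull (z -ᶜ w)
IsNull-- z w z-null w-null = IsNull-+ z ((-ᴿ re w) +i (-ᴿ im w)) z-null (IsNull-neg w w-null)

IsNull-*ˡ : ∀ z w → IsNull w → IsNull (z *ᶜ w)
IsNull-*ˡ z w (r , i) =
  Null-+ {λ n → seq (re z) n * seq (re w) n} {λ n → - (seq (im z) n * seq (im w) n)}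
    (Null-*ˡ (re z) {seq (re w)} r)
    (Null-neg {λ n → seq (im z) n * seq (im w) n} (Null-*ˡ (im z) {seq (im w)} i)) ,
  Null-+ {λ n → seq (re z) n * seq (im w) n} {λ n → seq (im z) n * seq (re w) n}
    (Null-*ˡ (re z) {seq (im w)} i) (Null-*ˡ (im z) {seq (re w)} r)

≃0⇒Null : ∀ {x} → x ≃ 0ᴿ → Null (seq x)
≃0⇒Null {x} = Null-resp {λ n → seq x n - 0ℚ} {seq x} (λ n → ℚ.+-identityʳ (seq x n))

Null⇒≃0 : ∀ {x} → Null (seq x) → x ≃ 0ᴿ
Null⇒≃0 {x} = Null-resp {seq x} {λ n → seq x n - 0ℚ} (λ n → sym (ℚ.+-identityʳ (seq x n)))

normSq : ℂ → ℝ
normSq z = re z *ᴿ re z +ᴿ im z *ᴿ im z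

normSq-null⇒IsNull : ∀ z → Null (seq (normSq z)) → IsNull z
normSq-null⇒IsNull z null =
  component (seq (re z)) (λ n → ≤-+ʳ (0≤p*p (seq (im z) n))) ,
  component (seq (im z)) (λ n → ≤-by (seq (re z) n * seq (re z) n)
    (ℚ.+-comm (seq (im z) n * seq (im z) n) (seq (re z) n * seq (re z) n)) (0≤p*p (seq (re z) n)))
  where
  component : ∀ x → (∀ n → x n * x n ℚ.≤ seq (normSq z) n) → Null x
  component x x²≤ ε 0<ε with null (ε * ε) (*-pos 0<ε 0<ε)
  ... | N , p = N , λ n N≤n → p*p<q*q⇒p<q (ℚ.<⇒≤ 0<ε) (ℚ.≤-<-trans
    (ℚ.≤-reflexive (trans (sym (ℚ.∣p*q∣≡∣p∣*∣q∣ (x n) (x n))) (ℚ.0≤p⇒∣p∣≡p (0≤p*p (x n)))))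
    (ℚ.≤-<-trans (x²≤ n) (ℚ.≤-<-trans (p≤∣p∣ (seq (normSq z) n)) (p n N≤n))))

normSq-nonNeg : ∀ z n → 0ℚ ℚ.≤ seq (normSq z) n
normSq-nonNeg z n = +-nonNeg (0≤p*p (seq (re z) n)) (0≤p*p (seq (im z) n))

IsNull⇒normSq-null : ∀ z → IsNull z → Null (seq (normSq z))
IsNull⇒normSq-null z (r , i) =
  Null-+ {λ n → seq (re z) n * seq (re z) n} {λ n → seq (im z) n * seq (im z) n}
  (Null-*ˡ (re z) {seq (re z)} r) (Null-*ˡ (im z) {seq (im z)} i)

0≮normSq⇒IsNull : ∀ z → ¬ (0ᴿ <ᴿ normSq z) → IsNull z
0≮normSq⇒IsNull z 0≮Z = normSq-null⇒IsNull z λ ε 0<ε →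
  let N , Z≤ = ≮⇒≥ᴿ {normSq z} {0ᴿ} 0≮Z (½ * ε) (half-pos 0<ε)
  in N , λ n N≤n → ℚ.≤-<-trans
       (ℚ.≤-reflexive (ℚ.0≤p⇒∣p∣≡p (normSq-nonNeg z n)))
       (ℚ.≤-<-trans (subst (seq (normSq z) n ℚ.≤_) (ℚ.+-identityˡ (½ * ε)) (Z≤ n N≤n))
         (subst (½ * ε ℚ.<_) (half+half ε) (<-by (½ * ε) refl (half-pos 0<ε))))

0<normSq⇒¬IsNull : ∀ z → 0ᴿ <ᴿ normSq z → ¬ IsNull z
0<normSq⇒¬IsNull z (δ , 0<δ , N₁ , δ≤Z) z-null with IsNull⇒normSq-null z z-null δ 0<δ
... | N₂ , Z<δ = ℚ.<-irrefl refl (ℚ.≤-<-trans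
  (subst (ℚ._≤ seq (normSq z) n) (ℚ.+-identityˡ δ) (δ≤Z n (ℕ.m≤m⊔n N₁ N₂)))
  (ℚ.≤-<-trans (p≤∣p∣ (seq (normSq z) n)) (Z<δ n (ℕ.m≤n⊔m N₁ N₂))))
  where
  n : ℕ
  n = N₁ ℕ.⊔ N₂

IsNull-stable : ∀ z → ¬ ¬ IsNull z → IsNull z
IsNull-stable z ¬¬null = 0≮normSq⇒IsNull z λ 0<Z → ¬¬null (0<normSq⇒¬IsNull z 0<Z)

normSq-homo-* : ∀ z w n → seq (normSq (z *ᶜ w)) n ≡ seq (normSq z) n * seq (normSq w) n
normSq-homo-* z w n = solve 4 (λ a b c d →
  (a :* c :+ (:- (b :* d))) :* (a :* c :+ (:- (b :* d))) :+ (a :* d :+ b :* c) :*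
    (a :* d :+ b :* c) :=
  (a :* a :+ b :* b) :* (c :* c :+ d :* d)) refl
  (seq (re z) n) (seq (im z) n) (seq (re w) n) (seq (im w) n)
  where open +-*-Solver

-- Absence of zero divisors, by multiplicativity of `normSq`. Stability of `IsNull` allows assuming
-- `0ᴿ <ᴿ normSq z`, whose witness `δ` gives a lower bound to divide by.
IsNull-*-cancelˡ : ∀ z w → ¬ IsNull z → IsNull (z *ᶜ w) → IsNull w
IsNull-*-cancelˡ z w z≄0 zw-null = IsNull-stable w λ w≄0 →
  z≄0 (0≮normSq⇒IsNull z λ 0<Z → w≄0 (normSq-null⇒IsNull w (W-null 0<Z)))
  where
  W-null : 0ᴿ <ᴿ normSq z → Null (seq (normSq w))
  W-null (δ , 0<δ , N₁ , δ≤Z) ε 0<ε with IsNull⇒normSq-null (z *ᶜ w) zw-null (δ * ε) (*-pos 0<δ 0<ε)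
  ... | N₂ , ZW< = N₁ ℕ.⊔ N₂ , λ n N≤n →
    let W = seq (normSq w) n
        0≤W = normSq-nonNeg w n
    in ℚ.≤-<-trans (ℚ.≤-reflexive (ℚ.0≤p⇒∣p∣≡p 0≤W))
      (ℚ.*-cancelˡ-<-nonNeg δ {{ℚ.nonNegative (ℚ.<⇒≤ 0<δ)}}
        (ℚ.≤-<-trans (ℚ.*-monoʳ-≤-nonNeg W {{ℚ.nonNegative 0≤W}}
            (subst (ℚ._≤ seq (normSq z) n) (ℚ.+-identityˡ δ) (δ≤Z n (ℕ.m⊔n≤o⇒m≤o N₁ N₂ N≤n))))
          (ℚ.≤-<-trans (p≤∣p∣ (seq (normSq z) n * W))
            (subst (λ q → ℚ.∣ q ∣ ℚ.< δ * ε) (normSq-homo-* z w n) (ZW< n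
              (ℕ.m⊔n≤o⇒n≤o N₁ N₂ N≤n))))))

-- Roots of polynomials

0ᶜ-null : IsNull 0ᶜ
0ᶜ-null = (λ ε 0<ε → 0 , λ _ _ → 0<ε) , (λ ε 0<ε → 0 , λ _ _ → 0<ε)

≃0⇒IsNull : ∀ z → z ≃ᶜ 0ᶜ → IsNull z
≃0⇒IsNull z (r , i) = ≃0⇒Null {re z} r , ≃0⇒Null {im z} i

IsNull⇒≃0 : ∀ z → IsNull z → z ≃ᶜ 0ᶜ
IsNull⇒≃0 z (r , i) = Null⇒≃0 {re z} r , Null⇒≃0 {im z} i

IsNull-diff : ∀ z w → IsNull (z -ᶜ w) → IsNull w → IsNull z
IsNull-diff z w z-w-null w-null = IsNull-resp {(z -ᶜ w) +ᶜ w} {z}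
  (λ n → a-b+b (seq (re z) n) (seq (re w) n) , a-b+b (seq (im z) n) (seq (im w) n))
  (IsNull-+ (z -ᶜ w) w z-w-null w-null)

eval-cong : ∀ f z w → IsNull (z -ᶜ w) → IsNull (eval f z -ᶜ eval f w)
eval-cong []      z w z-w-null = 0ᶜ-null
eval-cong (c ∷ f) z w z-w-null = IsNull-resp
  -- The decomposition `zF - wG = z (F - G) + G (z - w)`.
  {z *ᶜ (F -ᶜ G) +ᶜ G *ᶜ (z -ᶜ w)} {(c +ᶜ z *ᶜ F) -ᶜ (c +ᶜ w *ᶜ G)}
  (λ n →
    solve 9 (λ c a b a′ b′ p q p′ q′ →
      a :* (p :- p′) :+ (:- (b :* (q :- q′))) :+ (p′ :* (a :- a′) :+ (:- (q′ :* (b :- b′)))) :=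
      c :+ (a :* p :+ (:- (b :* q))) :+ (:- (c :+ (a′ :* p′ :+ (:- (b′ :* q′)))))) refl
      (seq (re c) n) (seq (re z) n) (seq (im z) n) (seq (re w) n) (seq (im w) n)
      (seq (re F) n) (seq (im F) n) (seq (re G) n) (seq (im G) n) ,
    solve 9 (λ c a b a′ b′ p q p′ q′ →
      a :* (q :- q′) :+ b :* (p :- p′) :+ (p′ :* (b :- b′) :+ q′ :* (a :- a′)) :=
      c :+ (a :* q :+ b :* p) :+ (:- (c :+ (a′ :* q′ :+ b′ :* p′)))) refl
      (seq (im c) n) (seq (re z) n) (seq (im z) n) (seq (re w) n) (seq (im w) n)
      (seq (re F) n) (seq (im F) n) (seq (re G) n) (seq (im G) n))
  (IsNull-+ (z *ᶜ (F -ᶜ G)) (G *ᶜ (z -ᶜ w))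
    (IsNull-*ˡ z (F -ᶜ G) (eval-cong f z w z-w-null)) (IsNull-*ˡ G (z -ᶜ w) z-w-null))
  where
  open +-*-Solver
  F G : ℂ
  F = eval f z
  G = eval f w

conj : ℂ → ℂ
conj z = re z +i (-ᴿ im z)

-- Conjugation respects sums and products, and fixes each coefficient up to a null difference
-- because its imaginary part is null.
eval-conj : ∀ f z → HasRealCoefficients f → IsNull (eval f (conj z) -ᶜ conj (eval f z))
eval-conj []      z []              = 0ᶜ-null
eval-conj (c ∷ f) z (c-real ∷ real) = IsNull-resp
  {(c -ᶜ conj c) +ᶜ conj z *ᶜ (F -ᶜ conj G)} {(c +ᶜ conj z *ᶜ F) -ᶜ conj (c +ᶜ z *ᶜ G)}
  (λ n →
    solve 7 (λ c a b p q p′ q′ →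
      c :+ (:- c) :+ (a :* (p :- p′) :+ (:- ((:- b) :* (q :+ (:- (:- q′)))))) :=
      c :+ (a :* p :+ (:- ((:- b) :* q))) :+ (:- (c :+ (a :* p′ :+ (:- (b :* q′)))))) refl
      (seq (re c) n) (seq (re z) n) (seq (im z) n)
      (seq (re F) n) (seq (im F) n) (seq (re G) n) (seq (im G) n) ,
    solve 7 (λ c a b p q p′ q′ →
      c :+ (:- (:- c)) :+ (a :* (q :+ (:- (:- q′))) :+ (:- b) :* (p :+ (:- p′))) :=
      c :+ (a :* q :+ (:- b) :* p) :+ (:- (:- (c :+ (a :* q′ :+ b :* p′))))) refl
      (seq (im c) n) (seq (re z) n) (seq (im z) n)
      (seq (re F) n) (seq (im F) n) (seq (re G) n) (seq (im G) n))
  (IsNull-+ (c -ᶜ conj c) (conj z *ᶜ (F -ᶜ conj G)) c-conj-null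
    (IsNull-*ˡ (conj z) (F -ᶜ conj G) (eval-conj f z real)))
  where
  open +-*-Solver
  F G : ℂ
  F = eval f (conj z)
  G = eval f z
  im-null : Null (seq (im c))
  im-null = ≃0⇒Null {im c} c-real
  c-conj-null : IsNull (c -ᶜ conj c)
  c-conj-null =
    Null-resp {λ _ → 0ℚ} (λ n → sym (ℚ.+-inverseʳ (seq (re c) n))) (proj₁ 0ᶜ-null) ,
    Null-+ {seq (im c)} {λ n → - (- seq (im c) n)} im-null
      (Null-neg {λ n → - seq (im c) n} (Null-neg {seq (im c)} im-null))

-- Synthetic division by `x - a`: each coefficient is a Horner value at `a` of a tail of `f`. The
-- list keeps the length of `f`, with a trailing zero.
quotient : ℂ → ℂ[x] → ℂ[x]
quotient a []      = []
quotient a (c ∷ f) = eval f a ∷ quotient a f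

-- For `c + x g` the difference of values is `(z - a) g(a) + z (g(z) - g(a))`, and the induction
-- hypothesis factors the second term.
eval-quotient : ∀ a f z → (z -ᶜ a) *ᶜ eval (quotient a f) z ≐ eval f z -ᶜ eval f a
eval-quotient a []      z n =
  solve 2 (λ x y → x :* con 0ℚ :+ (:- (y :* con 0ℚ)) := con 0ℚ) refl
    (seq (re (z -ᶜ a)) n) (seq (im (z -ᶜ a)) n) ,
  solve 2 (λ x y → x :* con 0ℚ :+ y :* con 0ℚ := con 0ℚ) refl
    (seq (re (z -ᶜ a)) n) (seq (im (z -ᶜ a)) n)
  where open +-*-Solver
eval-quotient a (c ∷ f) z n = trans re-left re-right , trans im-left im-right
  where
  open +-*-Solver
  F A Q : ℂ
  F = eval f z
  A = eval f a
  Q = eval (quotient a f) z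
  x y a₁ a₂ p q s t F₁ F₂ : ℚ
  x = seq (re z) n
  y = seq (im z) n
  a₁ = seq (re a) n
  a₂ = seq (im a) n
  p = seq (re Q) n
  q = seq (im Q) n
  s = seq (re A) n
  t = seq (im A) n
  F₁ = seq (re F) n
  F₂ = seq (im F) n
  ih-re : seq (re ((z -ᶜ a) *ᶜ Q)) n ≡ F₁ + (- s)
  ih-re = proj₁ (eval-quotient a f z n)
  ih-im : seq (im ((z -ᶜ a) *ᶜ Q)) n ≡ F₂ + (- t)
  ih-im = proj₂ (eval-quotient a f z n)
  re-left : seq (re ((z -ᶜ a) *ᶜ (A +ᶜ z *ᶜ Q))) n ≡
    (x - a₁) * s - (y - a₂) * t + (x * (F₁ + (- s)) - y * (F₂ + (- t)))
  re-left = trans (solve 8 (λ x y a₁ a₂ p q s t →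
      (x :+ (:- a₁)) :* (s :+ (x :* p :+ (:- (y :* q)))) :+ (:- ((y :+ (:- a₂)) :* (t :+
        (x :* q :+ y :* p)))) :=
      (x :- a₁) :* s :- (y :- a₂) :* t :+
      (x :* ((x :+ (:- a₁)) :* p :+ (:- ((y :+ (:- a₂)) :* q))) :- y :* ((x :+ (:- a₁)) :* q :+
        (y :+ (:- a₂)) :* p)))
      refl x y a₁ a₂ p q s t)
    (cong₂ (λ u v → (x - a₁) * s - (y - a₂) * t + (x * u - y * v)) ih-re ih-im)
  im-left : seq (im ((z -ᶜ a) *ᶜ (A +ᶜ z *ᶜ Q))) n ≡
    (x - a₁) * t + (y - a₂) * s + (x * (F₂ + (- t)) + y * (F₁ + (- s)))
  im-left = trans (solve 8 (λ x y a₁ a₂ p q s t →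
      (x :+ (:- a₁)) :* (t :+ (x :* q :+ y :* p)) :+ (y :+ (:- a₂)) :* (s :+ (x :* p :+ (:-
        (y :* q)))) :=
      (x :- a₁) :* t :+ (y :- a₂) :* s :+
      (x :* ((x :+ (:- a₁)) :* q :+ (y :+ (:- a₂)) :* p) :+ y :* ((x :+ (:- a₁)) :* p :+ (:- ((y :+
        (:- a₂)) :* q)))))
      refl x y a₁ a₂ p q s t)
    (cong₂ (λ u v → (x - a₁) * t + (y - a₂) * s + (x * v + y * u)) ih-re ih-im)
  re-right : (x - a₁) * s - (y - a₂) * t + (x * (F₁ + (- s)) - y * (F₂ + (- t))) ≡
    seq (re ((c +ᶜ z *ᶜ F) -ᶜ (c +ᶜ a *ᶜ A))) n
  re-right = solve 9 (λ c x y a₁ a₂ s t F₁ F₂ →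
      (x :- a₁) :* s :- (y :- a₂) :* t :+ (x :* (F₁ :+ (:- s)) :- y :* (F₂ :+ (:- t))) :=
      c :+ (x :* F₁ :+ (:- (y :* F₂))) :+ (:- (c :+ (a₁ :* s :+ (:- (a₂ :* t))))))
    refl (seq (re c) n) x y a₁ a₂ s t F₁ F₂
  im-right : (x - a₁) * t + (y - a₂) * s + (x * (F₂ + (- t)) + y * (F₁ + (- s))) ≡
    seq (im ((c +ᶜ z *ᶜ F) -ᶜ (c +ᶜ a *ᶜ A))) n
  im-right = solve 9 (λ c x y a₁ a₂ s t F₁ F₂ →
      (x :- a₁) :* t :+ (y :- a₂) :* s :+ (x :* (F₂ :+ (:- t)) :+ y :* (F₁ :+ (:- s))) :=
      c :+ (x :* F₂ :+ y :* F₁) :+ (:- (c :+ (a₁ :* t :+ a₂ :* s))))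
    refl (seq (im c) n) x y a₁ a₂ s t F₁ F₂

coeff-quotient : ∀ a f k → coeff (quotient a f) k ≡ eval (drop (suc k) f) a
coeff-quotient a []      k       = refl
coeff-quotient a (c ∷ f) zero    = refl
coeff-quotient a (c ∷ f) (suc k) = coeff-quotient a f k

coeff-drop : ∀ n f k → coeff (drop n f) k ≡ coeff f (n ℕ.+ k)
coeff-drop zero    f       k = refl
coeff-drop (suc n) []      k = refl
coeff-drop (suc n) (c ∷ f) k = coeff-drop n f k

eval-null : ∀ f a → (∀ k → IsNull (coeff f k)) → IsNull (eval f a)
eval-null []      a null = 0ᶜ-null
eval-null (c ∷ f) a null = IsNull-+ c (a *ᶜ eval f a) (null 0)
  (IsNull-*ˡ a (eval f a) (eval-null f a (λ k → null (suc k))))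

eval-constant : ∀ f a → (∀ k → IsNull (coeff f (suc k))) → IsNull (eval f a -ᶜ coeff f 0)
eval-constant []      a null = 0ᶜ-null
eval-constant (c ∷ f) a null = IsNull-resp {a *ᶜ eval f a} {(c +ᶜ a *ᶜ eval f a) -ᶜ c}
  (λ n → sym (a+b-a (seq (re c) n) (seq (re (a *ᶜ eval f a)) n)) ,
         sym (a+b-a (seq (im c) n) (seq (im (a *ᶜ eval f a)) n)))
  (IsNull-*ˡ a (eval f a) (eval-null f a null))

eval-drop : ∀ n f a → (∀ k → n ℕ.< k → IsNull (coeff f k)) → IsNull (eval (drop n f) a -ᶜ coeff f n)
eval-drop n f a null = subst (λ c → IsNull (eval (drop n f) a -ᶜ c))
  (trans (coeff-drop n f 0) (cong (coeff f) (ℕ.+-identityʳ n)))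
  (eval-constant (drop n f) a (λ k → subst IsNull (sym (coeff-drop n f (suc k)))
    (null (n ℕ.+ suc k) (ℕ.m<m+n n ℕ.z<s))))

IsNull-swap : ∀ z w → IsNull (z -ᶜ w) → IsNull (w -ᶜ z)
IsNull-swap z w null = IsNull-resp {(-ᴿ re (z -ᶜ w)) +i (-ᴿ im (z -ᶜ w))} {w -ᶜ z}
  (λ n → sym (-[a-b] (seq (re z) n) (seq (re w) n)) , sym (-[a-b] (seq (im z) n) (seq (im w) n)))
  (IsNull-neg (z -ᶜ w) null)

-- Induction on the degree bound: dividing by `x - a` for the first root `a` keeps the other roots,
-- since `z - a` can be cancelled, and keeps the leading coefficient.
too-many-roots : ∀ n f (b : Fin (suc n) → ℂ) → (∀ {i j} → i Fin.< j → ¬ IsNull (b j -ᶜ b i)) →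
  (∀ i → IsNull (eval f (b i))) → (∀ k → n ℕ.< k → IsNull (coeff f k)) → IsNull (coeff f n)
too-many-roots zero f b distinct roots above = IsNull-diff (coeff f 0) (eval f (b Fin.zero))
  (IsNull-swap (eval f (b Fin.zero)) (coeff f 0)
    (eval-constant f (b Fin.zero) (λ k → above (suc k) ℕ.z<s)))
  (roots Fin.zero)
too-many-roots (suc n) f b distinct roots above =
  IsNull-diff (coeff f (suc n)) (coeff q n)
    (subst (λ c → IsNull (coeff f (suc n) -ᶜ c)) (sym (coeff-quotient a f n))
      (IsNull-swap (eval (drop (suc n) f) a) (coeff f (suc n)) (eval-drop (suc n) f a above)))
    (too-many-roots n q (λ i → b (Fin.suc i)) (λ i<j → distinct (ℕ.s<s i<j)) q-roots q-above)
  where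
  a : ℂ
  a = b Fin.zero
  q : ℂ[x]
  q = quotient a f
  q-roots : ∀ i → IsNull (eval q (b (Fin.suc i)))
  q-roots i = IsNull-*-cancelˡ (z -ᶜ a) (eval q z) (distinct {Fin.zero} {Fin.suc i} ℕ.z<s)
    (IsNull-resp {eval f z -ᶜ eval f a} {(z -ᶜ a) *ᶜ eval q z}
      (λ n → sym (proj₁ (eval-quotient a f z n)) , sym (proj₂ (eval-quotient a f z n)))
      (IsNull-- (eval f z) (eval f a) (roots (Fin.suc i)) (roots Fin.zero)))
    where
    z : ℂ
    z = b (Fin.suc i)
  q-above : ∀ k → n ℕ.< k → IsNull (coeff q k)
  q-above k n<k = subst IsNull (sym (coeff-quotient a f k))
    (IsNull-diff (eval (drop (suc k) f) a) (coeff f (suc k))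
      (eval-drop (suc k) f a (λ j k<j → above j (ℕ.<-trans (ℕ.s<s n<k) k<j)))
      (above (suc k) (ℕ.s<s n<k)))

1ᶜ-not-null : ¬ IsNull 1ᶜ
1ᶜ-not-null (r , _) with r 1ℚ (ℚ.positive⁻¹ 1ℚ)
... | N , 1<1 = ℚ.<-irrefl refl (1<1 N ℕ.≤-refl)

-- A root different from all listed ones would make `n + 1` distinct roots, forcing the leading
-- coefficient 1 to vanish.
¬¬-root-listed : ∀ {n f} → MonicOfDegree n f → (s : Separable n f) → ∀ z → IsRoot f z →
  ¬ ¬ (∃[ j ] root s j ≃ᶜ z)
¬¬-root-listed {n} {f} (leading , above) s z z-root none =
  1ᶜ-not-null (IsNull-diff 1ᶜ (coeff f n) (IsNull-swap (coeff f n) 1ᶜ leading)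
    (too-many-roots n f b b-distinct b-roots (λ k n<k → ≃0⇒IsNull (coeff f k) (above k n<k))))
  where
  b : Fin (suc n) → ℂ
  b Fin.zero    = z
  b (Fin.suc j) = root s j
  b-distinct : ∀ {i j} → i Fin.< j → ¬ IsNull (b j -ᶜ b i)
  b-distinct {Fin.zero}  {Fin.suc j} _         null = none (j , null)
  b-distinct {Fin.suc i} {Fin.suc j} (ℕ.s<s i<j) null = distinct s {j} {i}
    (λ { refl → ℕ.<-irrefl refl i<j }) null
  b-roots : ∀ i → IsNull (eval f (b i))
  b-roots Fin.zero    = ≃0⇒IsNull (eval f z) z-root
  b-roots (Fin.suc j) = ≃0⇒IsNull (eval f (root s j)) (isRoot s j)

-- Conjugate roots and the second bound

conj-root : ∀ f z → HasRealCoefficients f → IsRoot f z → IsRoot f (conj z)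
conj-root f z real z-root = IsNull⇒≃0 (eval f (conj z))
  (IsNull-diff (eval f (conj z)) (conj (eval f z)) (eval-conj f z real)
    (conj-null (≃0⇒IsNull (eval f z) z-root)))
  where
  conj-null : IsNull (eval f z) → IsNull (conj (eval f z))
  conj-null (r , i) = r , Null-neg {seq (im (eval f z))} i

conj-fixed⇒IsReal : ∀ z → z ≃ᶜ conj z → IsReal z
conj-fixed⇒IsReal z (_ , 2im-null) = Null⇒≃0 {im z} (Null-resp
  {λ n → ½ * (seq (im z) n + (- (- seq (im z) n)))} {seq (im z)}
  (λ n → solve 1 (λ x → con ½ :* (x :+ (:- (:- x))) := x) refl (seq (im z) n))
  (Null-*ˡ (fromℚ ½) {λ n → seq (im z) n + (- (- seq (im z) n))} 2im-null))
  where open +-*-Solver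

-- `|z - w|² ≤ 2|z|² + 2|w|² = 4|z|² + 2(|w|² - |z|²)`, where the last term tends to 0.
conj-distance : ∀ z w → w ≃ᶜ conj z → ∣ z -ᶜ w ∣ᶜ ≤ᴿ fromℕ 2 *ᴿ ∣ z ∣ᶜ
conj-distance z w (re-null , im-null) ε 0<ε =
  -- One `η` absorbs the excess, kept below `η²`; the other is twice the rounding error `½ * η` of
  -- the modulus.
  let η = ½ * ε
      0<η = half-pos 0<ε
      N₁ , excess = excess-null (η * η) (*-pos 0<η 0<η)
      N₂ , u< = unit-small (½ * η) (half-pos 0<η)
  in N₁ ℕ.⊔ N₂ , λ n N≤n → bound n η (ℚ.<⇒≤ 0<η) (half+half ε)
       (ℚ.<⇒≤ (ℚ.≤-<-trans (p≤∣p∣ _) (excess n (ℕ.m⊔n≤o⇒m≤o N₁ N₂ N≤n))))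
       (ℚ.<⇒≤ (u< n (ℕ.m⊔n≤o⇒n≤o N₁ N₂ N≤n)))
  where
  open +-*-Solver
  excess-null : Null (λ n → ι 2 * (∥ at n w ∥² - ∥ at n z ∥²))
  excess-null = Null-*ˡ (fromℕ 2) {λ n → ∥ at n w ∥² - ∥ at n z ∥²} (Null-resp
    -- With `z = a + bi` and `w = c + di`, the difference of squared norms is
    -- `(c + a)(c - a) + (d - b)(d + b)`, and `c - a` and `d + b` are null.
    {λ n → seq (re w +ᴿ re z) n * (seq (re w) n + (- seq (re z) n)) +
           seq (im w -ᴿ im z) n * (seq (im w) n + (- (- seq (im z) n)))}
    {λ n → ∥ at n w ∥² - ∥ at n z ∥²}
    (λ n → solve 4 (λ a b c d → (c :+ a) :* (c :+ (:- a)) :+ (d :+ (:- b)) :* (d :+ (:- (:- b))) :=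
      c :* c :+ d :* d :- (a :* a :+ b :* b)) refl
      (seq (re z) n) (seq (im z) n) (seq (re w) n) (seq (im w) n))
    (Null-+ {λ n → seq (re w +ᴿ re z) n * (seq (re w) n + (- seq (re z) n))}
            {λ n → seq (im w -ᴿ im z) n * (seq (im w) n + (- (- seq (im z) n)))}
      (Null-*ˡ (re w +ᴿ re z) {λ n → seq (re w) n + (- seq (re z) n)} re-null)
      (Null-*ˡ (im w -ᴿ im z) {λ n → seq (im w) n + (- (- seq (im z) n))} im-null)))
  bound : ∀ n η → 0ℚ ℚ.≤ η → η + η ≡ ε →
    ι 2 * (∥ at n w ∥² - ∥ at n z ∥²) ℚ.≤ η * η → unit n ℚ.≤ ½ * η →
    modulus n (at n (z -ᶜ w)) ℚ.≤ ι 2 * modulus n (at n z) + ε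
  bound n η 0≤η η+η≡ε excess u≤ = begin
    r                        ≤⟨ p*p≤q*q⇒p≤q (+-nonNeg (*-nonNeg (ι-nonNeg 2) 0≤v) 0≤η) square ⟩
    ι 2 * v + η
      ≤⟨ ℚ.+-monoˡ-≤ η (ℚ.*-monoˡ-≤-nonNeg (ι 2) (ℚ.+-monoʳ-≤ (modulus n Z) u≤)) ⟩
    ι 2 * (modulus n Z + ½ * η) + η
      ≡⟨ solve 2 (λ m h → con (ι 2) :* (m :+ con ½ :* h) :+ h := con (ι 2) :* m :+ (h :+ h))
        refl (modulus n Z) η ⟩
    ι 2 * modulus n Z + (η + η)  ≡⟨ cong (ι 2 * modulus n Z +_) η+η≡ε ⟩
    ι 2 * modulus n Z + ε    ∎
    where
    open ℚ.≤-Reasoning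
    Z W : Point
    Z = at n z
    W = at n w
    r v : ℚ
    r = modulus n (at n (z -ᶜ w))
    v = modulus n Z + unit n
    0≤v : 0ℚ ℚ.≤ v
    0≤v = +-nonNeg (rootApprox-nonNeg 2 (∥ Z ∥² ℚ.⊔ 0ℚ) n) (unit-nonNeg n)
    square : r * r ℚ.≤ (ι 2 * v + η) * (ι 2 * v + η)
    square = begin
      r * r                                       ≤⟨ modulus²≤∥∥² n (at n (z -ᶜ w)) ⟩
      distSq Z W                                  ≤⟨ distSq≤ Z W ⟩
      ι 2 * ∥ Z ∥² + ι 2 * ∥ W ∥²
        ≡⟨ solve 2 (λ b w → con (ι 2) :* b :+ con (ι 2) :* w :=
          con (ι 4) :* b :+ con (ι 2) :* (w :- b)) refl ∥ Z ∥² ∥ W ∥² ⟩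
      ι 4 * ∥ Z ∥² + ι 2 * (∥ W ∥² - ∥ Z ∥²)
        ≤⟨ ℚ.+-mono-≤ (ℚ.*-monoˡ-≤-nonNeg (ι 4) (∥∥²≤[modulus+unit]² n Z)) excess ⟩
      ι 4 * v ^ 2 + η * η                         ≡⟨ cong (λ p → ι 4 * p + η * η) (p^2≡p*p v) ⟩
      ι 4 * (v * v) + η * η                       ≤⟨ ≤-by (ι 4 * (v * η))
        (solve 2 (λ v h → con (ι 4) :* (v :* v) :+ h :* h :+ con (ι 4) :* (v :* h) :=
          (con (ι 2) :* v :+ h) :* (con (ι 2) :* v :+ h)) refl v η)
        (*-nonNeg (ι-nonNeg 4) (*-nonNeg 0≤v 0≤η)) ⟩
      (ι 2 * v + η) * (ι 2 * v + η)               ∎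

nonreal-minimal⇒sep≤ : ∀ {n f} → MonicOfDegree n f → (s : Separable n f) → HasRealCoefficients f →
  ∀ i → HasMinimalModulus s i → ¬ IsReal (root s i) → ∀ k → sep s ≤ᴿ fromℕ 2 *ᴿ ∣ root s k ∣ᶜ
nonreal-minimal⇒sep≤ {n} {f} monic s real i i-min nonreal k =
  ≤ᴿ-stable {sep s} {bound k} λ sep≰ →
    ¬¬-root-listed monic s (conj α) (conj-root f α real (isRoot s i)) λ (j , αⱼ≃ᾱ) →
      sep≰ (≤ᴿ-trans {sep s} {∣ α -ᶜ root s j ∣ᶜ} {bound k} (sep≤ j αⱼ≃ᾱ)
        (≤ᴿ-trans {∣ α -ᶜ root s j ∣ᶜ} {bound i} {bound k} (conj-distance α (root s j) αⱼ≃ᾱ)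
          (double-mono-≤ᴿ {∣ α ∣ᶜ} {∣ root s k ∣ᶜ} (i-min k))))
  where
  α : ℂ
  α = root s i
  bound : Fin n → ℝ
  bound l = fromℕ 2 *ᴿ ∣ root s l ∣ᶜ
  sep≤ : ∀ j → root s j ≃ᶜ conj α → sep s ≤ᴿ ∣ α -ᶜ root s j ∣ᶜ
  sep≤ j αⱼ≃ᾱ ε 0<ε = 0 , λ m _ → ℚ.≤-trans
    -- If `j = i`, then `α` would equal its conjugate and be real.
    (sep-≤ s {i} {j} (λ { refl → nonreal (conj-fixed⇒IsReal α αⱼ≃ᾱ) }) m) (≤-+ʳ (ℚ.<⇒≤ 0<ε))

no-real-root⇒nonreal : ∀ {n f} (s : Separable n f) → (∀ x → ¬ IsRoot f (fromℝ x)) →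
  ∀ i → ¬ IsReal (root s i)
no-real-root⇒nonreal {f = f} s no-real i α-real = no-real (re α) (IsNull⇒≃0 (eval f (fromℝ (re α)))
  (IsNull-diff (eval f (fromℝ (re α))) (eval f α)
    (eval-cong f (fromℝ (re α)) α difference-null) (≃0⇒IsNull (eval f α) (isRoot s i))))
  where
  α : ℂ
  α = root s i
  difference-null : IsNull (fromℝ (re α) -ᶜ α)
  difference-null =
    Null-resp {λ _ → 0ℚ} (λ n → sym (ℚ.+-inverseʳ (seq (re α) n))) (proj₁ 0ᶜ-null) ,
    Null-resp {λ n → - seq (im α) n} (λ n → sym (ℚ.+-identityˡ (- seq (im α) n)))
      (Null-neg {seq (im α)} (≃0⇒Null {im α} α-real))

theorem1p2 : ∀ (n : ℕ) (2≤n : 2 ≤ n) (f : ℂ[x]) → MonicOfDegree n f → (s : Separable n f) →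
    (sep s ≤ᴿ constant n 2≤n *ᴿ (mahlerMeasure s ^1/ (n ∸ 1)))
    × (HasRealCoefficients f →
    ((∃[ i ] (HasMinimalModulus s i × ¬ IsReal (root s i))) →
    sep s ≤ᴿ constant n 2≤n *ᴿ (mahlerMeasure s ^1/ n))
    × ((∀ (x : ℝ) → ¬ IsRoot f (fromℝ x)) →
    sep s ≤ᴿ constant n 2≤n *ᴿ (mahlerMeasure s ^1/ n)))
theorem1p2 (suc zero) (ℕ.s≤s ())
theorem1p2 n@(suc (suc k)) 2≤n f monic s =
  -- The root has index `k + 1 = n - 1`, the number of roots left after dropping one.
  separation-≤ n 2≤n k (sep s) (mahlerMeasure s) ℕ.≤-refl (general-configuration s) ,
  λ real → nonreal-minimal-case real , λ no-real →
    -- A root of least modulus exists only under double negation, which the stable goal permits.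
    ≤ᴿ-stable {sep s} {constant n 2≤n *ᴿ (mahlerMeasure s ^1/ n)} λ sep≰ →
      ¬¬-minimal (λ i → ∣ root s i ∣ᶜ) λ (i , i-min) →
        sep≰ (nonreal-minimal-case real (i , i-min , no-real-root⇒nonreal s no-real i))
  where
  nonreal-minimal-case : HasRealCoefficients f →
    (∃[ i ] (HasMinimalModulus s i × ¬ IsReal (root s i))) →
    sep s ≤ᴿ constant n 2≤n *ᴿ (mahlerMeasure s ^1/ n)
  nonreal-minimal-case real (i , i-min , nonreal) =
    separation-≤ n 2≤n (suc k) (sep s) (mahlerMeasure s) (ℕ.n≤1+n n)
      (far-configuration s (nonreal-minimal⇒sep≤ monic s real i i-min nonreal))
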